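{- Let $G(V,E)$ be a graph on $n$ vertices with $\mathrm{MM}(G)=\omega(k\log n)$, and let $G^{(1)},\ldots,G^{(k)}$ be a random $k$-partition of $G$. Then the algorithm that outputs any maximum matching of $G^{(i)}$ is a $(3+o(1))$-approximation randomized composable coreset of size $O(n)$ for the maximum matching problem; i.e., for arbitrary maximum matchings $M_i$ of $G^{(i)}$, $i\in[k]$, with high probability the graph with edge set $M_1\cup\cdots\cup M_k$ contains a matching of size at least $\mathrm{MM}(G)/(3+o(1))$.
   Context: $\mathrm{MM}(G)$ denotes the size of a maximum matching of $G$. A random $k$-partition of $G(V,E)$ sends each edge independently to one of $k$ edge sets $E^{(1)},\ldots,E^{(k)}$ chosen uniformly at random, with $G^{(i)}=(V,E^{(i)})$. An $\alpha$-approximation randomized composable coreset for matching is an algorithm ALG returning a subgraph such that, for a random $k$-partition, the maximum matching of $\mathrm{ALG}(G^{(1)})\cup\cdots\cup\mathrm{ALG}(G^{(k)})$ has size at least $\mathrm{MM}(G)/\alpha$ with high probability; its size is the number of edges returned. -}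

module Defs where

open import Data.Nat using (ℕ; _≤_; _<_)
open import Data.Fin as Fin using (Fin)
open import Data.List using (List; []; _∷_; length; concatMap)
open import Data.Vec using (Vec; []; _∷_)
open import Data.Product using (_×_)
open import Data.List.Relation.Unary.AllPairs using (AllPairs)
open import Data.List.Relation.Binary.Subset.Propositional using (_⊆_)
open import Relation.Binary.PropositionalEquality using (_≢_)
open import Relation.Nullary using (yes; no)

-- An (undirected, loopless) edge on vertex set Fin n, stored canonically as u < v.
record Edge (n : ℕ) : Set where
  constructor edge
  field
    u : Fin n
    v : Fin n
    u<v : u Fin.< v
open Edge public

-- A simple graph on Fin n is given by its edge list E (required Unique in the theorem).

Disjoint : ∀ {n} → Edge n → Edge n → Set
Disjoint e f = (u e ≢ u f) × (u e ≢ v f) × (v e ≢ u f) × (v e ≢ v f)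

-- A matching: a list of pairwise vertex-disjoint edges (hence also duplicate-free).
IsMatching : ∀ {n} → List (Edge n) → Set
IsMatching M = AllPairs Disjoint M

IsMaxMatching : ∀ {n} → List (Edge n) → List (Edge n) → Set
IsMaxMatching {n} E M =
  (M ⊆ E) × IsMatching M ×
  ((M' : List (Edge n)) → M' ⊆ E → IsMatching M' → length M' ≤ length M)

-- A k-partition of the edge list E: a label in Fin k for each edge (in order).
-- All k ^ length E labellings are equally likely (random k-partition).
Partition : ∀ {n} → ℕ → List (Edge n) → Set
Partition k E = Vec (Fin k) (length E)

piece : ∀ {n k} (E : List (Edge n)) → Partition k E → Fin k → List (Edge n)
piece [] [] i = []
piece (e ∷ E) (j ∷ p) i with j Fin.≟ i
... | yes _ = e ∷ piece E p i
... | no  _ = piece E p i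

unionAll : ∀ {n} k → (Fin k → List (Edge n)) → List (Edge n)
unionAll k Ms = concatMap Ms (Data.List.allFin k)
  where import Data.List

{-# OPTIONS --safe #-}
module Submission where

open import Defs
open import Data.Nat using (ℕ; suc; _≤_; _*_; _+_; _^_)
open import Data.Nat.Logarithm using (⌊log₂_⌋)
open import Data.Fin using (Fin)
open import Data.List using (List; length)
open import Data.List.Relation.Unary.Unique.Propositional using (Unique)
open import Data.List.Relation.Binary.Subset.Propositional using (_⊆_)
open import Data.List.Membership.Propositional using (_∈_)
open import Data.Product using (Σ; ∃; _×_)
open import Relation.Nullary using (¬_)

import Data.Fin as Fin
open import Data.List using ([]; _∷_; _++_; allFin; cartesianProductWith; filter; map)
import Data.List.Membership.DecPropositional as DecMembership
open import Data.List.Membership.Propositional using (_∉_)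
open import Data.List.Membership.Propositional.Properties using (∈-++⁺ˡ; ∈-++⁺ʳ; ∈-++⁻; ∈-allFin; ∈-cartesianProductWith⁺; ∈-concatMap⁺; ∈-filter⁺; ∈-filter⁻; ∈-insert; ∈-∃++)
open import Data.List.Properties using (filter-accept; filter-all; filter-reject; length-++; length-tabulate; map-tabulate)
open import Data.List.Relation.Binary.Permutation.Propositional.Properties using (↭-length)
open import Data.List.Relation.Binary.Subset.Propositional.Properties using (filter-⊆; ++⁺ʳ)
open import Data.List.Relation.Ternary.Interleaving.Propositional using (Interleaving; []; consˡ; consʳ; toPermutation)
import Data.List.Relation.Ternary.Interleaving.Setoid.Properties as Interleaving
open import Data.List.Relation.Unary.All as All using (All; []; _∷_)
import Data.List.Relation.Unary.All.Properties as All
open import Data.List.Relation.Unary.AllPairs as AllPairs using ([]; _∷_)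
import Data.List.Relation.Unary.AllPairs.Properties as AllPairs
open import Data.List.Relation.Unary.Any as Any using (here; there; any?)
import Data.List.Relation.Unary.Unique.Propositional.Properties as Unique
open import Data.Nat using (zero; _<_; _∸_; _/_; _%_; _≤?_; NonZero; >-nonZero; z≤n; s≤s; s≤s⁻¹)
open import Data.Nat.DivMod using (/-monoˡ-≤; m%n<n; m*n/n≡m; m/n*n≤m; m≡m%n+[m/n]*n)
open import Data.Nat.Logarithm using (⌊log₂[2^n]⌋≡n; ⌊log₂⌋-mono-≤)
open import Data.Nat.Properties
open import Data.Nat.Tactic.RingSolver using (solve-∀)
open import Data.Product using (_,_; proj₁; proj₂)
open import Data.Sum using (_⊎_; inj₁; inj₂)
open import Data.Vec using (Vec; []; _∷_)
open import Data.Vec.Properties using (∷-injective)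
open import Function using (_∘_; const; id)
open import Relation.Binary.PropositionalEquality using (_≡_; _≢_; refl; sym; trans; cong; cong₂; subst; subst₂; ≢-sym; setoid; module ≡-Reasoning)
open import Relation.Nullary using (Dec; yes; no; ¬?; contradiction; _×-dec_; _⊎-dec_)
open import Relation.Unary using (Decidable)

-- Resample the labels of the edges of a maximum matching M* of size m, keeping all other labels
-- fixed, and let Φ be the sum over the pieces of their maximum matching sizes. Relabelling one
-- edge changes Φ by at most 1, so with high probability Φ is not below its mean by a constant
-- fraction of m. Suppose however that every M_i has size at most about m/3 and that the union
-- of the M_i contains at most about m/3 edges of M*. Each M_i leaves at least m - 2|M_i|, so
-- more than m/3, edges of M* untouched, and each of these would enlarge M_i if it were sent to
-- piece i. A fresh labelling hence gains more than m/3 edges on average, while it loses at most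
-- the edges of M* that lie in the union: Φ is far below its mean. So with high probability
-- some M_i, or the part of M* in the union, is a matching of the required size, whatever
-- maximum matchings M_i are chosen.

-- Only the `m` labels of the maximum matching are resampled because a deviation of order `m` over
-- `m` independent labels has probability exponentially small in `m`; the same bounded-difference
-- estimate over all labels would degrade with the number of edges. Φ depends on the labelling
-- alone, so the bad set is fixed before the `M_i` are chosen and no union bound over their choices
-- arises. The cut-off is a balance: if all sizes are x m, the mean gain is at least (1 - 2x) m and
-- the loss at most x m, which break even at x = 1/3. The fraction d/(3d + 1) lies just below and
-- leaves a deficit of m/(3d + 1). Probabilities are counts in ℕ, and (1 + 1/q)^Φ, scaled to be
-- integral, takes the place of an exponential moment. The mean of Φ may be fractional, so nothing
-- is centred at it: the mean of (1 + 1/q)^Φ times the mean of its reciprocal is bounded by (1 +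
-- 1/q²)^m, one coordinate at a time, and Jensen's inequality then bounds the first factor from
-- below.

private variable
  A B : Set
  n k : ℕ

-- Finite sums of natural numbers

*-exchange : ∀ a b c → a * (b * c) ≡ b * (a * c)
*-exchange = solve-∀

∑ : List A → (A → ℕ) → ℕ
∑ []       f = 0
∑ (x ∷ xs) f = f x + ∑ xs f

syntax ∑ xs (λ x → e) = ∑[ x ∈ xs ] e

∑-cong : ∀ (xs : List A) {f g : A → ℕ} → (∀ x → f x ≡ g x) → ∑ xs f ≡ ∑ xs g
∑-cong []       f≡g = refl
∑-cong (x ∷ xs) f≡g = cong₂ _+_ (f≡g x) (∑-cong xs f≡g)

∑-mono : ∀ (xs : List A) {f g : A → ℕ} → (∀ x → f x ≤ g x) → ∑ xs f ≤ ∑ xs g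
∑-mono []       f≤g = z≤n
∑-mono (x ∷ xs) f≤g = +-mono-≤ (f≤g x) (∑-mono xs f≤g)

∑-mono-∈ : ∀ (xs : List A) {f g : A → ℕ} → (∀ {x} → x ∈ xs → f x ≤ g x) → ∑ xs f ≤ ∑ xs g
∑-mono-∈ []       f≤g = z≤n
∑-mono-∈ (x ∷ xs) f≤g = +-mono-≤ (f≤g (here refl)) (∑-mono-∈ xs (f≤g ∘ there))

∑-zero : ∀ (xs : List A) → ∑ xs (const 0) ≡ 0
∑-zero []       = refl
∑-zero (x ∷ xs) = ∑-zero xs

∑-const : ∀ (xs : List A) c → ∑ xs (const c) ≡ length xs * c
∑-const []       c = refl
∑-const (x ∷ xs) c = cong (c +_) (∑-const xs c)

+-interchange : ∀ a b c d → (a + b) + (c + d) ≡ (a + c) + (b + d)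
+-interchange = solve-∀

∑-+ : ∀ (xs : List A) (f g : A → ℕ) → ∑[ x ∈ xs ] (f x + g x) ≡ ∑ xs f + ∑ xs g
∑-+ []       f g = refl
∑-+ (x ∷ xs) f g = trans (cong (f x + g x +_) (∑-+ xs f g)) (+-interchange (f x) (g x) _ _)

∑-*ˡ : ∀ c (xs : List A) (f : A → ℕ) → ∑[ x ∈ xs ] (c * f x) ≡ c * ∑ xs f
∑-*ˡ c []       f = sym (*-zeroʳ c)
∑-*ˡ c (x ∷ xs) f = trans (cong (c * f x +_) (∑-*ˡ c xs f)) (sym (*-distribˡ-+ c (f x) _))

∑-*ʳ : ∀ (xs : List A) (f : A → ℕ) c → ∑[ x ∈ xs ] (f x * c) ≡ ∑ xs f * c
∑-*ʳ []       f c = refl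
∑-*ʳ (x ∷ xs) f c = trans (cong (f x * c +_) (∑-*ʳ xs f c)) (sym (*-distribʳ-+ c (f x) _))

∑-swap : ∀ (xs : List A) (ys : List B) (f : A → B → ℕ) →
         ∑[ x ∈ xs ] ∑[ y ∈ ys ] f x y ≡ ∑[ y ∈ ys ] ∑[ x ∈ xs ] f x y
∑-swap []       ys f = sym (∑-zero ys)
∑-swap (x ∷ xs) ys f = trans (cong (∑ ys (f x) +_) (∑-swap xs ys f))
                             (sym (∑-+ ys (f x) (λ y → ∑[ x ∈ xs ] f x y)))

∑-++ : ∀ (xs ys : List A) (f : A → ℕ) → ∑ (xs ++ ys) f ≡ ∑ xs f + ∑ ys f
∑-++ []       ys f = refl
∑-++ (x ∷ xs) ys f = trans (cong (f x +_) (∑-++ xs ys f)) (sym (+-assoc (f x) _ _))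

∑-map : ∀ (h : A → B) (xs : List A) (f : B → ℕ) → ∑ (map h xs) f ≡ ∑ xs (f ∘ h)
∑-map h []       f = refl
∑-map h (x ∷ xs) f = cong (f (h x) +_) (∑-map h xs f)

∑-cartesian : ∀ {C : Set} (h : A → B → C) xs ys (f : C → ℕ) →
              ∑ (cartesianProductWith h xs ys) f ≡ ∑[ x ∈ xs ] ∑[ y ∈ ys ] f (h x y)
∑-cartesian h []       ys f = refl
∑-cartesian h (x ∷ xs) ys f =
  trans (∑-++ (map (h x) ys) _ f) (cong₂ _+_ (∑-map (h x) ys f) (∑-cartesian h xs ys f))

∑-* : ∀ (xs : List A) (ys : List B) (f : A → ℕ) (g : B → ℕ) →
      ∑[ x ∈ xs ] ∑[ y ∈ ys ] (f x * g y) ≡ ∑ xs f * ∑ ys g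
∑-* xs ys f g = trans (∑-cong xs (λ x → ∑-*ˡ (f x) ys g)) (∑-*ʳ xs f (∑ ys g))

∈⇒≤∑ : ∀ {xs : List A} (f : A → ℕ) {x} → x ∈ xs → f x ≤ ∑ xs f
∈⇒≤∑ f (here refl) = m≤m+n _ _
∈⇒≤∑ f (there {x = y} x∈) = m≤n⇒m≤o+n (f y) (∈⇒≤∑ f x∈)

𝟙 : {P : Set} → Dec P → ℕ
𝟙 (yes _) = 1
𝟙 (no _)  = 0

-- Concentration on [k]^m

vecs : ∀ k m → List (Vec (Fin k) m)
vecs k zero    = [] ∷ []
vecs k (suc m) = cartesianProductWith _∷_ (allFin k) (vecs k m)

∈-vecs : ∀ {k m} (s : Vec (Fin k) m) → s ∈ vecs k m
∈-vecs []      = here refl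
∈-vecs (l ∷ s) = ∈-cartesianProductWith⁺ _∷_ (∈-allFin l) (∈-vecs s)

vecs-unique : ∀ k m → Unique (vecs k m)
vecs-unique k zero    = [] ∷ []
vecs-unique k (suc m) = Unique.cartesianProductWith⁺ _∷_ ∷-injective (Unique.allFin⁺ k) (vecs-unique k m)

∑-vecs-suc : ∀ k m (f : Vec (Fin k) (suc m) → ℕ) →
             ∑ (vecs k (suc m)) f ≡ ∑[ l ∈ allFin k ] ∑[ s ∈ vecs k m ] f (l ∷ s)
∑-vecs-suc k m f = ∑-cartesian _∷_ (allFin k) (vecs k m) f

length-allFin : ∀ k → length (allFin k) ≡ k
length-allFin k = length-tabulate id

∑-allFin-const : ∀ k c → ∑ (allFin k) (const c) ≡ k * c
∑-allFin-const k c = trans (∑-const (allFin k) c) (cong (_* c) (length-allFin k))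

∑-vecs-const : ∀ k m c → ∑ (vecs k m) (const c) ≡ k ^ m * c
∑-vecs-const k zero    c = refl
∑-vecs-const k (suc m) c =
  trans (∑-vecs-suc k m _)
  (trans (∑-cong (allFin k) (λ _ → ∑-vecs-const k m c))
  (trans (∑-allFin-const k (k ^ m * c)) (sym (*-assoc k (k ^ m) c))))

hamming : ∀ {k m} → Vec (Fin k) m → Vec (Fin k) m → ℕ
hamming []      []        = 0
hamming (l ∷ s) (l' ∷ s') = 𝟙 (¬? (l Fin.≟ l')) + hamming s s'

hamming-tail : ∀ {k m} (l : Fin k) (s s' : Vec (Fin k) m) → hamming (l ∷ s) (l ∷ s') ≤ hamming s s'
hamming-tail l s s' with l Fin.≟ l
... | yes _  = ≤-refl
... | no l≢l = contradiction refl l≢l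

hamming-refl : ∀ {k m} (s : Vec (Fin k) m) → hamming s s ≡ 0
hamming-refl [] = refl
hamming-refl (l ∷ s) = n≤0⇒n≡0 (≤-trans (hamming-tail l s s) (≤-reflexive (hamming-refl s)))

𝟙≤1 : ∀ {P : Set} (P? : Dec P) → 𝟙 P? ≤ 1
𝟙≤1 (yes _) = ≤-refl
𝟙≤1 (no _)  = z≤n

hamming-head : ∀ {k m} (l l' : Fin k) (s : Vec (Fin k) m) → hamming (l ∷ s) (l' ∷ s) ≤ 1
hamming-head l l' s =
  +-mono-≤ (𝟙≤1 (¬? (l Fin.≟ l'))) (≤-reflexive (hamming-refl s))

-- The multiplicative counterpart of `Lipschitz`: changing one label changes `f` by a factor of at
-- most 1 + 1/q. As `hamming` is symmetric, the factor is bounded in both directions.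
RatioBounded : ∀ {k m} → ℕ → (Vec (Fin k) m → ℕ) → Set
RatioBounded q f = ∀ s s' → hamming s s' ≤ 1 → q * f s ≤ suc q * f s'

Lipschitz : ∀ {k m} → (Vec (Fin k) m → ℕ) → Set
Lipschitz Φ = ∀ s s' → Φ s ≤ Φ s' + hamming s s'

private
  expand-same : ∀ q x y s t → suc (q * q) * (x * y + (x + s) * (y + t))
              ≡ q * q * (x * (y + t) + (x + s) * y) + (q * q * (s * t) + (x * y + (x + s) * (y + t)))
  expand-same = solve-∀

  expand-opposite : ∀ q x y s t → q * q * (x * y + (x + s) * (y + t))
                  ≡ q * q * (x * (y + t) + (x + s) * y) + (q * s) * (q * t)
  expand-opposite = solve-∀

  expand-excess : ∀ x y s t → x * (y + t) + (x + s) * y ≡ x * y + (x * t + (x + s) * y)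
  expand-excess = solve-∀

  excess-bound : ∀ q x {s} → q * (x + s) ≤ suc q * x → q * s ≤ x
  excess-bound q x {s} h =
    +-cancelʳ-≤ (q * x) (q * s) x
      (≤-trans (≤-reflexive (trans (+-comm (q * s) (q * x)) (sym (*-distribˡ-+ q x s)))) h)

-- If the ratios x'/x and y'/y lie in [q/(q+1), (q+1)/q], then |x' - x| |y' - y| is at most
-- (xy + x'y')/q²; this second-order error is what makes the concentration bound subgaussian.
cross-terms : ∀ q {x x' y y'} → q * x ≤ suc q * x' → q * x' ≤ suc q * x →
              q * y ≤ suc q * y' → q * y' ≤ suc q * y →
              q * q * (x * y' + x' * y) ≤ suc (q * q) * (x * y + x' * y')
cross-terms q {x} {x'} {y} {y'} h₁ h₂ h₃ h₄ = by-order (≤-total x x') (≤-total y y')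
  where
  -- For similarly ordered pairs this is the rearrangement inequality; only the opposite order
  -- incurs the second-order error.
  same : ∀ {x x' y y'} → x ≤ x' → y ≤ y' →
         q * q * (x * y' + x' * y) ≤ suc (q * q) * (x * y + x' * y')
  same {x} {y = y} x≤x' y≤y' with m≤n⇒∃[o]m+o≡n x≤x' | m≤n⇒∃[o]m+o≡n y≤y'
  ... | s , refl | t , refl = ≤-trans (m≤m+n _ _) (≤-reflexive (sym (expand-same q x y s t)))

  opposite : ∀ {x x' y y'} → q * x' ≤ suc q * x → q * y ≤ suc q * y' → x ≤ x' → y' ≤ y →
             q * q * (x * y' + x' * y) ≤ suc (q * q) * (x * y + x' * y')
  opposite {x} {y' = y} h h' x≤x' y'≤y with m≤n⇒∃[o]m+o≡n x≤x' | m≤n⇒∃[o]m+o≡n y'≤y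
  ... | s , refl | t , refl = begin
    q * q * (x * y + (x + s) * (y + t))                           ≡⟨ expand-opposite q x y s t ⟩
    q * q * xy′ + (q * s) * (q * t)                               ≤⟨ +-monoʳ-≤ (q * q * xy′) (*-mono-≤ (excess-bound q x h) (excess-bound q y h')) ⟩
    q * q * xy′ + x * y                                           ≤⟨ +-monoʳ-≤ (q * q * xy′) (≤-trans (m≤m+n (x * y) _) (≤-reflexive (sym (expand-excess x y s t)))) ⟩
    q * q * xy′ + xy′                                             ≡⟨ +-comm (q * q * xy′) xy′ ⟩
    suc (q * q) * xy′                                             ∎
    where
    open ≤-Reasoning
    xy′ = x * (y + t) + (x + s) * y

  flip : q * q * (x' * y + x * y') ≤ suc (q * q) * (x' * y' + x * y) →
         q * q * (x * y' + x' * y) ≤ suc (q * q) * (x * y + x' * y')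
  flip = subst₂ _≤_ (cong (q * q *_) (+-comm (x' * y) _)) (cong (suc (q * q) *_) (+-comm (x' * y') _))

  by-order : x ≤ x' ⊎ x' ≤ x → y ≤ y' ⊎ y' ≤ y →
             q * q * (x * y' + x' * y) ≤ suc (q * q) * (x * y + x' * y')
  by-order (inj₁ x≤x') (inj₁ y≤y') = same x≤x' y≤y'
  by-order (inj₁ x≤x') (inj₂ y'≤y) = opposite h₂ h₃ x≤x' y'≤y
  by-order (inj₂ x'≤x) (inj₁ y≤y') = flip (opposite h₁ h₄ x'≤x y≤y')
  by-order (inj₂ x'≤x) (inj₂ y'≤y) = flip (same x'≤x y'≤y)

-- Symmetrising the double sum pairs `f x * g y` with `f y * g x`, and `cross-terms` trades each
-- pair for diagonal products. This is Chebyshev's sum inequality reversed, at the price of a factor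
-- 1 + 1/q².
∑-product≤ : ∀ {A : Set} q (xs : List A) (f g : A → ℕ) →
             (∀ x y → q * f x ≤ suc q * f y) → (∀ x y → q * g x ≤ suc q * g y) →
             q * q * (∑ xs f * ∑ xs g) ≤ suc (q * q) * (length xs * ∑[ x ∈ xs ] (f x * g x))
∑-product≤ q xs f g hf hg = *-cancelˡ-≤ 2 (begin
  2 * (q * q * (∑ xs f * ∑ xs g))
    ≡⟨ cong (λ z → 2 * (q * q * z)) (∑-* xs xs f g) ⟨
  2 * (q * q * ∑[ x ∈ xs ] ∑[ y ∈ xs ] (f x * g y))
    ≡⟨ double-sum ⟨
  q * q * ∑[ x ∈ xs ] ∑[ y ∈ xs ] (f x * g y + f y * g x)
    ≡⟨ scale (q * q) (λ x y → f x * g y + f y * g x) ⟨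
  ∑[ x ∈ xs ] ∑[ y ∈ xs ] (q * q * (f x * g y + f y * g x))
    ≤⟨ ∑-mono xs (λ x → ∑-mono xs (λ y → cross-terms q (hf x y) (hf y x) (hg x y) (hg y x))) ⟩
  ∑[ x ∈ xs ] ∑[ y ∈ xs ] (suc (q * q) * (f x * g x + f y * g y))
    ≡⟨ scale (suc (q * q)) (λ x y → f x * g x + f y * g y) ⟩
  suc (q * q) * ∑[ x ∈ xs ] ∑[ y ∈ xs ] (f x * g x + f y * g y)
    ≡⟨ cong (suc (q * q) *_) diagonal ⟩
  suc (q * q) * (2 * (length xs * D))
    ≡⟨ *-exchange (suc (q * q)) 2 (length xs * D) ⟩
  2 * (suc (q * q) * (length xs * D)) ∎)
  where
  open ≤-Reasoning
  D = ∑[ x ∈ xs ] (f x * g x)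
  two : ∀ a → a + a ≡ 2 * a
  two = solve-∀
  scale : ∀ c (h : _ → _ → ℕ) → ∑[ x ∈ xs ] ∑[ y ∈ xs ] (c * h x y) ≡ c * ∑[ x ∈ xs ] ∑[ y ∈ xs ] h x y
  scale c h = trans (∑-cong xs (λ x → ∑-*ˡ c xs (h x))) (∑-*ˡ c xs _)
  split : ∀ (h h' : _ → _ → ℕ) → ∑[ x ∈ xs ] ∑[ y ∈ xs ] (h x y + h' x y)
        ≡ ∑[ x ∈ xs ] ∑[ y ∈ xs ] h x y + ∑[ x ∈ xs ] ∑[ y ∈ xs ] h' x y
  split h h' = trans (∑-cong xs (λ x → ∑-+ xs (h x) (h' x))) (∑-+ xs _ _)
  double-sum : q * q * ∑[ x ∈ xs ] ∑[ y ∈ xs ] (f x * g y + f y * g x)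
             ≡ 2 * (q * q * ∑[ x ∈ xs ] ∑[ y ∈ xs ] (f x * g y))
  double-sum =
    trans (cong (q * q *_) (trans (split (λ x y → f x * g y) (λ x y → f y * g x))
      (trans (cong (S +_) (∑-swap xs xs (λ x y → f y * g x))) (two S))))
    (*-exchange (q * q) 2 S)
    where S = ∑[ x ∈ xs ] ∑[ y ∈ xs ] (f x * g y)
  diagonal : ∑[ x ∈ xs ] ∑[ y ∈ xs ] (f x * g x + f y * g y) ≡ 2 * (length xs * D)
  diagonal =
    trans (split (λ x y → f x * g x) (λ x y → f y * g y))
    (trans (cong₂ _+_ (trans (∑-cong xs (λ x → ∑-const xs (f x * g x))) (∑-*ˡ (length xs) xs _))
                      (∑-const xs D))
    (two (length xs * D)))

-- Tensorisation: each coordinate costs one factor 1 + 1/q². The ratio bound holds for every fixed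
-- tail, hence survives summation over the tails, so the one-coordinate inequality applies to the
-- sums `F` and `G`; the diagonal products that it leaves are the same problem with one coordinate
-- fewer.
∑-vecs-product≤ : ∀ q k m c (f g : Vec (Fin k) m → ℕ) →
  (∀ s → f s * g s ≤ c) → RatioBounded q f → RatioBounded q g →
  (q * q) ^ m * (∑ (vecs k m) f * ∑ (vecs k m) g) ≤ suc (q * q) ^ m * (k ^ m * (k ^ m * c))
∑-vecs-product≤ q k zero c f g fg≤c hf hg =
  subst₂ _≤_ (sym base) (sym (unit c)) (fg≤c [])
  where
  base : 1 * ((f [] + 0) * (g [] + 0)) ≡ f [] * g []
  base = trans (*-identityˡ ((f [] + 0) * (g [] + 0))) (cong₂ _*_ (+-identityʳ (f [])) (+-identityʳ (g [])))
  unit : ∀ c → 1 * (1 * (1 * c)) ≡ c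
  unit = solve-∀
∑-vecs-product≤ q k (suc m) c f g fg≤c hf hg = begin
  Q * Q ^ m * (∑ (vecs k (suc m)) f * ∑ (vecs k (suc m)) g)
    ≡⟨ cong₂ (λ x y → Q * Q ^ m * (x * y)) (∑-vecs-suc k m f) (∑-vecs-suc k m g) ⟩
  Q * Q ^ m * (∑ (allFin k) F * ∑ (allFin k) G)
    ≡⟨ rotate Q (Q ^ m) _ ⟩
  Q ^ m * (Q * (∑ (allFin k) F * ∑ (allFin k) G))
    ≤⟨ *-monoʳ-≤ (Q ^ m) (∑-product≤ q (allFin k) F G (heads f hf) (heads g hg)) ⟩
  Q ^ m * (suc Q * (length (allFin k) * ∑[ l ∈ allFin k ] (F l * G l)))
    ≡⟨ cong (λ x → Q ^ m * (suc Q * (x * ∑[ l ∈ allFin k ] (F l * G l)))) (length-allFin k) ⟩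
  Q ^ m * (suc Q * (k * ∑[ l ∈ allFin k ] (F l * G l)))
    ≡⟨ pull (Q ^ m) (suc Q) k _ ⟩
  suc Q * (k * (Q ^ m * ∑[ l ∈ allFin k ] (F l * G l)))
    ≡⟨ cong (λ x → suc Q * (k * x)) (∑-*ˡ (Q ^ m) (allFin k) _) ⟨
  suc Q * (k * ∑[ l ∈ allFin k ] (Q ^ m * (F l * G l)))
    ≤⟨ *-monoʳ-≤ (suc Q) (*-monoʳ-≤ k (∑-mono (allFin k) slices)) ⟩
  suc Q * (k * ∑ (allFin k) (const X))
    ≡⟨ cong (λ x → suc Q * (k * x)) (∑-allFin-const k X) ⟩
  suc Q * (k * (k * X))
    ≡⟨ collect (suc Q) k (suc Q ^ m) (k ^ m) c ⟩
  suc Q * suc Q ^ m * (k * k ^ m * (k * k ^ m * c)) ∎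
  where
  open ≤-Reasoning
  Q = q * q
  X = suc Q ^ m * (k ^ m * (k ^ m * c))
  F G : Fin k → ℕ
  F l = ∑[ s ∈ vecs k m ] f (l ∷ s)
  G l = ∑[ s ∈ vecs k m ] g (l ∷ s)
  heads : ∀ h → RatioBounded q h → ∀ l l' →
          q * (∑[ s ∈ vecs k m ] h (l ∷ s)) ≤ suc q * (∑[ s ∈ vecs k m ] h (l' ∷ s))
  heads h hh l l' =
    subst₂ _≤_ (∑-*ˡ q (vecs k m) _) (∑-*ˡ (suc q) (vecs k m) _)
      (∑-mono (vecs k m) (λ s → hh (l ∷ s) (l' ∷ s) (hamming-head l l' s)))
  tails : ∀ h l → RatioBounded q h → RatioBounded q (h ∘ (l ∷_))
  tails h l hh s s' d = hh (l ∷ s) (l ∷ s') (≤-trans (hamming-tail l s s') d)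
  slices : ∀ l → Q ^ m * (F l * G l) ≤ X
  slices l = ∑-vecs-product≤ q k m c (f ∘ (l ∷_)) (g ∘ (l ∷_)) (λ s → fg≤c (l ∷ s))
               (tails f l hf) (tails g l hg)
  rotate : ∀ a b c → a * b * c ≡ b * (a * c)
  rotate = solve-∀
  pull : ∀ a b c d → a * (b * (c * d)) ≡ b * (c * (a * d))
  pull = solve-∀
  collect : ∀ a k b p c → a * (k * (k * (b * (p * (p * c))))) ≡ a * b * (k * p * (k * p * c))
  collect = solve-∀

-- Bernoulli inequalities and integral exponential weights

bernoulli : ∀ q D → (q + D) * q ^ D ≤ q * suc q ^ D
bernoulli q zero    = ≤-reflexive (cong (_* 1) (+-identityʳ q))
bernoulli q (suc D) = begin
  (q + suc D) * (q * q ^ D)   ≤⟨ m≤m+n _ (D * q ^ D) ⟩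
  (q + suc D) * (q * q ^ D) + D * q ^ D ≡⟨ regroup q D (q ^ D) ⟩
  suc q * ((q + D) * q ^ D)   ≤⟨ *-monoʳ-≤ (suc q) (bernoulli q D) ⟩
  suc q * (q * suc q ^ D)     ≡⟨ *-exchange (suc q) q (suc q ^ D) ⟩
  q * (suc q * suc q ^ D)     ∎
  where
  open ≤-Reasoning
  regroup : ∀ q D x → (q + suc D) * (q * x) + D * x ≡ suc q * ((q + D) * x)
  regroup = solve-∀

-- Bernoulli's inequality (1 + 1/q)^(-D) ≥ 1 - D/q for a negative exponent, cleared of subtraction.
-- Together with `bernoulli` it keeps the exponential above its tangent on both sides of the point
-- of contact.
bernoulli⁻ : ∀ q D → q * suc q ^ D ≤ q * q ^ D + D * suc q ^ D
bernoulli⁻ q zero    = m≤m+n _ _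
bernoulli⁻ q (suc D) = begin
  q * (suc q * suc q ^ D)                      ≡⟨ *-exchange q (suc q) (suc q ^ D) ⟩
  suc q * (q * suc q ^ D)                      ≤⟨ *-monoʳ-≤ (suc q) (bernoulli⁻ q D) ⟩
  suc q * (q * q ^ D + D * suc q ^ D)          ≡⟨ regroup q D (q ^ D) (suc q ^ D) ⟩
  q * (q * q ^ D) + (q * q ^ D + D * (suc q * suc q ^ D))
    ≤⟨ +-monoʳ-≤ (q * (q * q ^ D)) (+-monoˡ-≤ _ (^-monoˡ-≤ (suc D) (n≤1+n q))) ⟩
  q * (q * q ^ D) + suc D * (suc q * suc q ^ D) ∎
  where
  open ≤-Reasoning
  regroup : ∀ q D x y → suc q * (q * x + D * y) ≡ q * (q * x) + (q * x + D * (suc q * y))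
  regroup = solve-∀

-- (1 + 1/q)^N scaled by q^R, so that it stays integral for N ≤ R.
weight : ℕ → ℕ → ℕ → ℕ
weight q R N = suc q ^ N * q ^ (R ∸ N)

private
  ∸-shift : ∀ {R} N D → N + D ≤ R → R ∸ N ≡ D + (R ∸ (N + D))
  ∸-shift {R} N D N+D≤R =
    trans (sym (m+[n∸m]≡n (m+n≤o⇒n≤o∸m N N+D≤R))) (cong (D +_) (∸-+-assoc R N D))
   where
   m+n≤o⇒n≤o∸m : ∀ m {n o} → m + n ≤ o → n ≤ o ∸ m
   m+n≤o⇒n≤o∸m m {n} h = m+n≤o⇒m≤o∸n n (≤-trans (≤-reflexive (+-comm n m)) h)

weight-raise : ∀ q R N D → N + D ≤ R → q ^ D * weight q R (N + D) ≡ suc q ^ D * weight q R N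
weight-raise q R N D N+D≤R = begin
  q ^ D * (suc q ^ (N + D) * X)      ≡⟨ cong (λ z → q ^ D * (z * X)) (^-distribˡ-+-* (suc q) N D) ⟩
  q ^ D * (suc q ^ N * suc q ^ D * X) ≡⟨ rearrange (q ^ D) (suc q ^ N) (suc q ^ D) X ⟩
  suc q ^ D * (suc q ^ N * (q ^ D * X)) ≡⟨ cong (λ z → suc q ^ D * (suc q ^ N * z)) (^-distribˡ-+-* q D _) ⟨
  suc q ^ D * (suc q ^ N * q ^ (D + (R ∸ (N + D)))) ≡⟨ cong (λ z → suc q ^ D * (suc q ^ N * q ^ z)) (∸-shift N D N+D≤R) ⟨
  suc q ^ D * (suc q ^ N * q ^ (R ∸ N)) ∎
  where
  open ≡-Reasoning
  X = q ^ (R ∸ (N + D))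
  rearrange : ∀ a b c d → a * (b * c * d) ≡ c * (b * (a * d))
  rearrange = solve-∀

-- The reflection `R ∸ N` supplies the reciprocal of a weight without division: the product does not
-- depend on `N`, which provides the constant `c` of `∑-vecs-product≤`.
weight*weight : ∀ q R N → N ≤ R → weight q R N * weight q R (R ∸ N) ≡ suc q ^ R * q ^ R
weight*weight q R N N≤R = begin
  suc q ^ N * q ^ (R ∸ N) * (suc q ^ (R ∸ N) * q ^ (R ∸ (R ∸ N)))
    ≡⟨ cong (λ z → suc q ^ N * q ^ (R ∸ N) * (suc q ^ (R ∸ N) * q ^ z)) (m∸[m∸n]≡n N≤R) ⟩
  suc q ^ N * q ^ (R ∸ N) * (suc q ^ (R ∸ N) * q ^ N)
    ≡⟨ rearrange (suc q ^ N) (q ^ (R ∸ N)) (suc q ^ (R ∸ N)) (q ^ N) ⟩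
  (suc q ^ N * suc q ^ (R ∸ N)) * (q ^ N * q ^ (R ∸ N))
    ≡⟨ cong₂ _*_ (^-distribˡ-+-* (suc q) N (R ∸ N)) (^-distribˡ-+-* q N (R ∸ N)) ⟨
  suc q ^ (N + (R ∸ N)) * q ^ (N + (R ∸ N))
    ≡⟨ cong (λ z → suc q ^ z * q ^ z) (m+[n∸m]≡n N≤R) ⟩
  suc q ^ R * q ^ R ∎
  where
  open ≡-Reasoning
  rearrange : ∀ a b c d → a * b * (c * d) ≡ (a * c) * (d * b)
  rearrange = solve-∀

module _ (q : ℕ) .{{_ : NonZero q}} (R : ℕ) where

  private
    W = weight q R

    cancel-q^ : ∀ D {x y} → q ^ D * x ≤ q ^ D * y → x ≤ y
    cancel-q^ D {x} {y} = *-cancelˡ-≤ (q ^ D) {{m^n≢0 q D}}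

  weight-mono : ∀ {N N'} → N ≤ N' → N' ≤ R → W N ≤ W N'
  weight-mono {N} N≤N' N'≤R with m≤n⇒∃[o]m+o≡n N≤N'
  ... | D , refl = cancel-q^ D (≤-trans (*-monoˡ-≤ (W N) (^-monoˡ-≤ D (n≤1+n q)))
                                        (≤-reflexive (sym (weight-raise q R N D N'≤R))))

  weight-step : ∀ {N N'} → N ≤ suc N' → N ≤ R → N' ≤ R → q * W N ≤ suc q * W N'
  weight-step {N} {N'} N≤1+N' N≤R N'≤R with m≤n⇒m<n∨m≡n N≤1+N'
  ... | inj₁ N<1+N' = *-mono-≤ (n≤1+n q) (weight-mono (s≤s⁻¹ N<1+N') N'≤R)
  ... | inj₂ refl   = ≤-reflexive (begin
    q * W (suc N')          ≡⟨ cong₂ (λ x y → x * W y) (*-identityʳ q) (+-comm N' 1) ⟨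
    q ^ 1 * W (N' + 1)      ≡⟨ weight-raise q R N' 1 (subst (_≤ R) (+-comm 1 N') N≤R) ⟩
    suc q ^ 1 * W N'        ≡⟨ cong (_* W N') (*-identityʳ (suc q)) ⟩
    suc q * W N'            ∎)
    where open ≡-Reasoning

  -- Convexity: the line through `N₀` with slope `W N₀` / q lies below the weight. To the left of
  -- `N₀` this is `bernoulli⁻`, to the right `bernoulli`.
  weight-tangent : ∀ {N N₀} → N ≤ R → N₀ ≤ R → q * W N₀ + N * W N₀ ≤ q * W N + N₀ * W N₀
  weight-tangent {N} {N₀} N≤R N₀≤R with ≤-total N N₀
  ... | inj₁ N≤N₀ with m≤n⇒∃[o]m+o≡n N≤N₀
  ...   | D , refl = begin
    q * W N₀ + N * W N₀         ≤⟨ +-monoˡ-≤ (N * W N₀) (cancel-q^ D scaled) ⟩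
    q * W N + D * W N₀ + N * W N₀ ≡⟨ regroup (q * W N) D N (W N₀) ⟩
    q * W N + (N + D) * W N₀    ∎
    where
    open ≤-Reasoning
    regroup : ∀ x D N w → x + D * w + N * w ≡ x + (N + D) * w
    regroup = solve-∀
    collect : ∀ q x y D w → (q * x + D * y) * w ≡ x * (q * w) + D * (y * w)
    collect = solve-∀
    spread : ∀ x z D w → x * z + D * (x * w) ≡ x * (z + D * w)
    spread = solve-∀
    raise : q ^ D * W N₀ ≡ suc q ^ D * W N
    raise = weight-raise q R N D N₀≤R
    scaled : q ^ D * (q * W N₀) ≤ q ^ D * (q * W N + D * W N₀)
    scaled = begin
      q ^ D * (q * W N₀)                ≡⟨ *-exchange (q ^ D) q (W N₀) ⟩
      q * (q ^ D * W N₀)                ≡⟨ cong (q *_) raise ⟩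
      q * (suc q ^ D * W N)             ≡⟨ *-assoc q _ _ ⟨
      q * suc q ^ D * W N               ≤⟨ *-monoˡ-≤ (W N) (bernoulli⁻ q D) ⟩
      (q * q ^ D + D * suc q ^ D) * W N ≡⟨ collect q (q ^ D) (suc q ^ D) D (W N) ⟩
      q ^ D * (q * W N) + D * (suc q ^ D * W N) ≡⟨ cong (λ z → q ^ D * (q * W N) + D * z) raise ⟨
      q ^ D * (q * W N) + D * (q ^ D * W N₀)    ≡⟨ spread (q ^ D) (q * W N) D (W N₀) ⟩
      q ^ D * (q * W N + D * W N₀)      ∎
  weight-tangent {N} {N₀} N≤R N₀≤R | inj₂ N₀≤N with m≤n⇒∃[o]m+o≡n N₀≤N
  ...   | D , refl = begin
    q * W N₀ + (N₀ + D) * W N₀  ≡⟨ regroup q N₀ D (W N₀) ⟩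
    (q + D) * W N₀ + N₀ * W N₀  ≤⟨ +-monoˡ-≤ (N₀ * W N₀) (cancel-q^ D scaled) ⟩
    q * W N + N₀ * W N₀         ∎
    where
    open ≤-Reasoning
    regroup : ∀ q N D w → q * w + (N + D) * w ≡ (q + D) * w + N * w
    regroup = solve-∀
    factor : ∀ x y w → x * (y * w) ≡ y * x * w
    factor = solve-∀
    scaled : q ^ D * ((q + D) * W N₀) ≤ q ^ D * (q * W N)
    scaled = begin
      q ^ D * ((q + D) * W N₀) ≡⟨ factor (q ^ D) (q + D) (W N₀) ⟩
      (q + D) * q ^ D * W N₀   ≤⟨ *-monoˡ-≤ (W N₀) (bernoulli q D) ⟩
      q * suc q ^ D * W N₀     ≡⟨ *-assoc q _ _ ⟩
      q * (suc q ^ D * W N₀)   ≡⟨ cong (q *_) (weight-raise q R N₀ D N≤R) ⟨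
      q * (q ^ D * W N)        ≡⟨ trans (sym (*-assoc q (q ^ D) (W N))) (sym (factor (q ^ D) q (W N))) ⟩
      q ^ D * (q * W N)        ∎

  -- The tangent inequality at `N₀`, summed. Any integer `N₀` not above the mean will do, so the
  -- weight is never evaluated at a fractional mean.
  weight-jensen : ∀ {A : Set} (xs : List A) (Φ : A → ℕ) {N₀} → (∀ x → Φ x ≤ R) → N₀ ≤ R →
                  length xs * N₀ ≤ ∑ xs Φ → length xs * W N₀ ≤ ∑[ x ∈ xs ] W (Φ x)
  weight-jensen xs Φ {N₀} Φ≤R N₀≤R h =
    *-cancelˡ-≤ q (+-cancelʳ-≤ (length xs * N₀ * W N₀) _ _ (begin
      q * (length xs * W N₀) + length xs * N₀ * W N₀
        ≤⟨ +-monoʳ-≤ _ (*-monoˡ-≤ (W N₀) h) ⟩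
      q * (length xs * W N₀) + ∑ xs Φ * W N₀
        ≡⟨ cong₂ _+_ (trans (*-exchange q (length xs) (W N₀)) (sym (∑-const xs (q * W N₀)))) (sym (∑-*ʳ xs Φ (W N₀))) ⟩
      ∑ xs (const (q * W N₀)) + ∑[ x ∈ xs ] (Φ x * W N₀)
        ≡⟨ ∑-+ xs _ _ ⟨
      ∑[ x ∈ xs ] (q * W N₀ + Φ x * W N₀)
        ≤⟨ ∑-mono xs (λ x → weight-tangent (Φ≤R x) N₀≤R) ⟩
      ∑[ x ∈ xs ] (q * W (Φ x) + N₀ * W N₀)
        ≡⟨ ∑-+ xs _ _ ⟩
      ∑[ x ∈ xs ] (q * W (Φ x)) + ∑ xs (const (N₀ * W N₀))
        ≡⟨ cong₂ _+_ (∑-*ˡ q xs _) (trans (∑-const xs _) (sym (*-assoc (length xs) N₀ (W N₀)))) ⟩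
      q * ∑[ x ∈ xs ] W (Φ x) + length xs * N₀ * W N₀ ∎))
    where open ≤-Reasoning

-- The lower tail of a Lipschitz function

length-vecs : ∀ k m → length (vecs k m) ≡ k ^ m
length-vecs k m = trans (sym (trans (∑-const (vecs k m) 1) (*-identityʳ _)))
                        (trans (∑-vecs-const k m 1) (*-identityʳ _))

hamming-sym : ∀ {k m} (s s' : Vec (Fin k) m) → hamming s s' ≡ hamming s' s
hamming-sym []      []        = refl
hamming-sym (l ∷ s) (l' ∷ s') = cong₂ _+_ (head l l') (hamming-sym s s')
  where
  head : ∀ l l' → 𝟙 (¬? (l Fin.≟ l')) ≡ 𝟙 (¬? (l' Fin.≟ l))
  head l l' with l Fin.≟ l' | l' Fin.≟ l
  ... | yes _    | yes _    = refl
  ... | no _     | no _     = refl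
  ... | yes l≡l' | no l'≢l  = contradiction (sym l≡l') l'≢l
  ... | no l≢l'  | yes l'≡l = contradiction (sym l'≡l) l≢l'

-- Cleared of division and subtraction, this is the hypothesis of `weight-jensen` at `N₀ = Φ s + g`.
FarBelowMean : ∀ {k m} → (Vec (Fin k) m → ℕ) → ℕ → Vec (Fin k) m → Set
FarBelowMean {k} {m} Φ g s = k ^ m * (Φ s + g) ≤ ∑ (vecs k m) Φ

farBelowMean? : ∀ {k m} (Φ : Vec (Fin k) m → ℕ) g s → Dec (FarBelowMean Φ g s)
farBelowMean? {k} {m} Φ g s = k ^ m * (Φ s + g) ≤? ∑ (vecs k m) Φ

-- In terms of probabilities: P(Φ ≤ mean - g) ≤ (1 + 1/q²)^m / (1 + 1/q)^g.
lower-tail : ∀ q .{{_ : NonZero q}} {k} .{{_ : NonZero k}} {m} (Φ : Vec (Fin k) m → ℕ) →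
             Lipschitz Φ → ∀ g →
             (∑[ s ∈ vecs k m ] 𝟙 (farBelowMean? Φ g s)) * (suc q ^ g * (q * q) ^ m)
               ≤ q ^ g * (suc (q * q) ^ m * k ^ m)
lower-tail q {k} {m} Φ lip g = *-cancelʳ-≤ _ _ (k ^ m * c) {{m*n≢0 (k ^ m) c}} (begin
  count * (a^g * Q^m) * (k ^ m * c)
    ≡⟨ collect count a^g Q^m (k ^ m) c ⟩
  Q^m * (count * (k ^ m * (a^g * c)))
    ≡⟨ cong (Q^m *_) (∑-*ʳ (vecs k m) _ _) ⟨
  Q^m * ∑[ s ∈ vecs k m ] (𝟙 (farBelowMean? Φ g s) * (k ^ m * (a^g * c)))
    ≤⟨ *-monoʳ-≤ Q^m (∑-mono (vecs k m) pointwise) ⟩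
  Q^m * ∑[ s ∈ vecs k m ] (q ^ g * (ΣW * W (R ∸ Φ s)))
    ≡⟨ cong (Q^m *_) (trans (∑-*ˡ (q ^ g) (vecs k m) _) (cong (q ^ g *_) (∑-*ˡ ΣW (vecs k m) _))) ⟩
  Q^m * (q ^ g * (ΣW * ∑[ s ∈ vecs k m ] W (R ∸ Φ s)))
    ≡⟨ *-exchange Q^m (q ^ g) _ ⟩
  q ^ g * (Q^m * (ΣW * ∑[ s ∈ vecs k m ] W (R ∸ Φ s)))
    ≤⟨ *-monoʳ-≤ (q ^ g) (∑-vecs-product≤ q k m c (W ∘ Φ) (λ s → W (R ∸ Φ s))
         (λ s → ≤-reflexive (weight*weight q R (Φ s) (Φ≤R s))) bounded cobounded) ⟩
  q ^ g * (suc (q * q) ^ m * (k ^ m * (k ^ m * c)))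
    ≡⟨ regroup (q ^ g) (suc (q * q) ^ m) (k ^ m) (k ^ m * c) ⟩
  q ^ g * (suc (q * q) ^ m * k ^ m) * (k ^ m * c) ∎)
  where
  open ≤-Reasoning
  -- A crude bound on every `Φ s + g`; it makes all truncated subtractions from `R` exact and
  -- cancels from the final estimate.
  R = g + ∑ (vecs k m) Φ
  W = weight q R
  c = suc q ^ R * q ^ R
  a^g = suc q ^ g
  Q^m = (q * q) ^ m
  ΣW = ∑[ s ∈ vecs k m ] W (Φ s)
  count = ∑[ s ∈ vecs k m ] 𝟙 (farBelowMean? Φ g s)
  instance
    k^m≢0 : NonZero (k ^ m)
    k^m≢0 = m^n≢0 k m
    c≢0 : NonZero c
    c≢0 = m*n≢0 (suc q ^ R) (q ^ R) {{m^n≢0 (suc q) R}} {{m^n≢0 q R}}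
  collect : ∀ n a b k c → n * (a * b) * (k * c) ≡ b * (n * (k * (a * c)))
  collect = solve-∀
  regroup : ∀ a b k x → a * (b * (k * x)) ≡ a * (b * k) * x
  regroup = solve-∀
  Φ≤ΣΦ : ∀ s → Φ s ≤ ∑ (vecs k m) Φ
  Φ≤ΣΦ s = ∈⇒≤∑ Φ (∈-vecs s)
  Φ≤R : ∀ s → Φ s ≤ R
  Φ≤R s = m≤n⇒m≤o+n g (Φ≤ΣΦ s)
  Φ-step : ∀ s s' → hamming s s' ≤ 1 → Φ s ≤ suc (Φ s')
  Φ-step s s' d = ≤-trans (lip s s') (≤-trans (+-monoʳ-≤ (Φ s') d) (≤-reflexive (+-comm (Φ s') 1)))
  bounded : RatioBounded q (W ∘ Φ)
  bounded s s' d = weight-step q R (Φ-step s s' d) (Φ≤R s) (Φ≤R s')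
  cobounded : RatioBounded q (λ s → W (R ∸ Φ s))
  cobounded s s' d = weight-step q R R∸Φ-step (m∸n≤m R (Φ s)) (m∸n≤m R (Φ s'))
    where
    R∸Φ-step : R ∸ Φ s ≤ suc (R ∸ Φ s')
    R∸Φ-step = m≤n+o⇒m∸n≤o R (Φ s) (≤-trans (m≤n+m∸n R (Φ s'))
      (≤-trans (+-monoˡ-≤ (R ∸ Φ s') (Φ-step s' s (≤-trans (≤-reflexive (hamming-sym s' s)) d)))
               (≤-reflexive (sym (+-suc (Φ s) _)))))
  -- Markov's inequality for the reciprocal weight: at a far `s`, Jensen's inequality at `Φ s + g`
  -- forces `W (R ∸ Φ s)` to be at least (1 + 1/q)^g times `k ^ m * c` / `ΣW`.
  pointwise : ∀ s → 𝟙 (farBelowMean? Φ g s) * (k ^ m * (a^g * c)) ≤ q ^ g * (ΣW * W (R ∸ Φ s))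
  pointwise s with farBelowMean? Φ g s
  ... | no _    = z≤n
  ... | yes far = begin
    1 * (k ^ m * (a^g * c))
      ≡⟨ *-identityˡ _ ⟩
    k ^ m * (a^g * c)
      ≡⟨ cong (λ z → k ^ m * (a^g * z)) (weight*weight q R (Φ s) (Φ≤R s)) ⟨
    k ^ m * (a^g * (W (Φ s) * W (R ∸ Φ s)))
      ≡⟨ cong (k ^ m *_) (*-assoc a^g (W (Φ s)) _) ⟨
    k ^ m * (a^g * W (Φ s) * W (R ∸ Φ s))
      ≡⟨ cong (λ z → k ^ m * (z * W (R ∸ Φ s))) (weight-raise q R (Φ s) g Φ+g≤R) ⟨
    k ^ m * (q ^ g * W (Φ s + g) * W (R ∸ Φ s))
      ≡⟨ pull (k ^ m) (q ^ g) (W (Φ s + g)) _ ⟩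
    q ^ g * (k ^ m * W (Φ s + g) * W (R ∸ Φ s))
      ≤⟨ *-monoʳ-≤ (q ^ g) (*-monoˡ-≤ (W (R ∸ Φ s)) jensen) ⟩
    q ^ g * (ΣW * W (R ∸ Φ s)) ∎
    where
    pull : ∀ k a w v → k * (a * w * v) ≡ a * (k * w * v)
    pull = solve-∀
    Φ+g≤R : Φ s + g ≤ R
    Φ+g≤R = ≤-trans (≤-reflexive (+-comm (Φ s) g)) (+-monoʳ-≤ g (Φ≤ΣΦ s))
    jensen : k ^ m * W (Φ s + g) ≤ ΣW
    jensen = subst (λ z → z * W (Φ s + g) ≤ ΣW) (length-vecs k m)
      (weight-jensen q R (vecs k m) Φ Φ≤R Φ+g≤R
        (subst (λ z → z * (Φ s + g) ≤ ∑ (vecs k m) Φ) (sym (length-vecs k m)) far))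

-- Choice of parameters

n<2^[1+⌊log₂n⌋] : ∀ n → n < 2 ^ suc ⌊log₂ n ⌋
n<2^[1+⌊log₂n⌋] n = ≰⇒> λ 2^≤n →
  1+n≰n (≤-trans (≤-reflexive (sym (⌊log₂[2^n]⌋≡n (suc ⌊log₂ n ⌋)))) (⌊log₂⌋-mono-≤ 2^≤n))

*-^-distrib : ∀ x y r → (x * y) ^ r ≡ x ^ r * y ^ r
*-^-distrib x y zero    = refl
*-^-distrib x y (suc r) = trans (cong (x * y *_) (*-^-distrib x y r)) (interchange x y _ _)
  where
  interchange : ∀ a b c d → a * b * (c * d) ≡ a * c * (b * d)
  interchange = solve-∀

^-mono-base : ∀ {u v x y} h → u * x ≤ y * v → u ^ h * x ^ h ≤ y ^ h * v ^ h
^-mono-base {u} {v} {x} {y} h le =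
  subst₂ _≤_ (*-^-distrib u x h) (*-^-distrib y v h) (^-monoˡ-≤ h le)

2≤[1+1/q]^q : ∀ q .{{_ : NonZero q}} → 2 * q ^ q ≤ suc q ^ q
2≤[1+1/q]^q q = *-cancelˡ-≤ q (≤-trans (≤-reflexive (factor q (q ^ q))) (bernoulli q q))
  where
  factor : ∀ q x → q * (2 * x) ≡ (q + q) * x
  factor = solve-∀

-- This is (1 + 1/x)^r ≤ 1/(1 - r/x) for x = y + r.
bernoulli-inverse : ∀ r y → suc (y + r) ^ r * y ≤ (y + r) ^ r * (y + r)
bernoulli-inverse zero    y = +-monoˡ-≤ 0 (m≤m+n y 0)
bernoulli-inverse (suc r) y = begin
  suc x * suc x ^ r * y         ≡⟨ rotate (suc x) (suc x ^ r) y ⟩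
  suc x ^ r * (suc x * y)       ≤⟨ *-monoʳ-≤ (suc x ^ r) step ⟩
  suc x ^ r * (suc y * x)       ≡⟨ *-assoc (suc x ^ r) (suc y) x ⟨
  suc x ^ r * suc y * x         ≤⟨ *-monoˡ-≤ x ih ⟩
  x ^ r * x * x                 ≡⟨ cong (_* x) (*-comm (x ^ r) x) ⟩
  x * x ^ r * x                 ∎
  where
  open ≤-Reasoning
  x = y + suc r
  rotate : ∀ a b c → a * b * c ≡ b * (a * c)
  rotate = solve-∀
  expand : ∀ y r → suc (y + suc r) * y + suc r ≡ suc y * (y + suc r)
  expand = solve-∀
  step : suc x * y ≤ suc y * x
  step = ≤-trans (m≤m+n _ (suc r)) (≤-reflexive (expand y r))
  ih : suc x ^ r * suc y ≤ x ^ r * x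
  ih = subst (λ z → suc z ^ r * suc y ≤ z ^ r * z) (sym (+-suc y r)) (bernoulli-inverse r (suc y))

-- With q = 2r, `bernoulli-inverse` bounds (1 + 1/q²)^r by 1/(1 - r/q²) = 1/(1 - 1/(2q)), which is
-- at most 1 + 1/q. The `y` of the proof is q² - r = r(4r - 1), written in `r-1` to avoid
-- subtraction.
square-vs-linear : ∀ r .{{_ : NonZero r}} → let q = 2 * r in
                   suc (q * q) ^ r * q ≤ suc q * (q * q) ^ r
square-vs-linear r@(suc r-1) = *-cancelʳ-≤ _ _ y (begin
  suc (q * q) ^ r * q * y    ≡⟨ swap (suc (q * q) ^ r) q y ⟩
  suc (q * q) ^ r * y * q    ≡⟨ cong (λ z → suc z ^ r * y * q) y+r≡q² ⟨
  suc (y + r) ^ r * y * q    ≤⟨ *-monoˡ-≤ q (bernoulli-inverse r y) ⟩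
  (y + r) ^ r * (y + r) * q  ≡⟨ cong (λ z → z ^ r * z * q) y+r≡q² ⟩
  (q * q) ^ r * (q * q) * q  ≡⟨ *-assoc ((q * q) ^ r) (q * q) q ⟩
  (q * q) ^ r * (q * q * q)  ≤⟨ *-monoʳ-≤ ((q * q) ^ r) (≤-trans (m≤m+n _ _) (≤-reflexive (cubic r-1))) ⟩
  (q * q) ^ r * (suc q * y)  ≡⟨ collect ((q * q) ^ r) (suc q) y ⟩
  suc q * (q * q) ^ r * y    ∎)
  where
  open ≤-Reasoning
  q = 2 * r
  y = r * (3 + 4 * r-1)
  y+r≡q² : y + r ≡ q * q
  y+r≡q² = square r-1
    where
    square : ∀ t → suc t * (3 + 4 * t) + suc t ≡ (2 * suc t) * (2 * suc t)
    square = solve-∀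
  cubic : ∀ t → (2 * suc t) * (2 * suc t) * (2 * suc t) + (2 * t * t + 3 * t + 1)
              ≡ suc (2 * suc t) * (suc t * (3 + 4 * t))
  cubic = solve-∀
  swap : ∀ a b c → a * b * c ≡ a * c * b
  swap = solve-∀
  collect : ∀ a b c → a * (b * c) ≡ b * a * c
  collect = solve-∀

square-vs-linear-^ : ∀ r .{{_ : NonZero r}} h m → m ≤ r * h → let q = 2 * r in
                     suc (q * q) ^ m * q ^ h ≤ suc q ^ h * (q * q) ^ m
square-vs-linear-^ r h m m≤rh with m≤n⇒∃[o]m+o≡n m≤rh
... | e , m+e≡rh = *-cancelʳ-≤ _ _ (Q ^ e) {{m^n≢0 Q e {{m*n≢0 q q}}}} (begin
  -- Padding by `e` factors raises the exponent `m` to exactly `r * h`, where `square-vs-linear` can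
  -- be taken to the power `h`.
  suc Q ^ m * q ^ h * Q ^ e        ≤⟨ *-monoʳ-≤ (suc Q ^ m * q ^ h) (^-monoˡ-≤ e (n≤1+n Q)) ⟩
  suc Q ^ m * q ^ h * suc Q ^ e    ≡⟨ swap (suc Q ^ m) (q ^ h) (suc Q ^ e) ⟩
  suc Q ^ m * suc Q ^ e * q ^ h    ≡⟨ cong (_* q ^ h) (split (suc Q)) ⟩
  (suc Q ^ r) ^ h * q ^ h          ≤⟨ ^-mono-base {suc Q ^ r} {Q ^ r} {q} {suc q} h (square-vs-linear r) ⟩
  suc q ^ h * (Q ^ r) ^ h          ≡⟨ cong (suc q ^ h *_) (split Q) ⟨
  suc q ^ h * (Q ^ m * Q ^ e)      ≡⟨ *-assoc (suc q ^ h) _ _ ⟨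
  suc q ^ h * Q ^ m * Q ^ e        ∎)
  where
  open ≤-Reasoning
  q = 2 * r
  Q = q * q
  instance
    q≢0 : NonZero q
    q≢0 = m*n≢0 2 r
  swap : ∀ a b c → a * b * c ≡ a * c * b
  swap = solve-∀
  split : ∀ x → x ^ m * x ^ e ≡ (x ^ r) ^ h
  split x = trans (sym (^-distribˡ-+-* x m e)) (trans (cong (x ^_) m+e≡rh) (sym (^-*-assoc x r h)))

-- Every block of `q` factors 1 + 1/q at least doubles the product, and `t = suc ⌊log₂ n ⌋ * c`
-- doublings reach `n ^ c`.
polynomial-vs-exponential : ∀ q .{{_ : NonZero q}} n c h → q * (suc ⌊log₂ n ⌋ * c) ≤ h →
                            n ^ c * q ^ h ≤ suc q ^ h
polynomial-vs-exponential q n c h qt≤h with m≤n⇒∃[o]m+o≡n qt≤h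
... | e , refl = begin
  n ^ c * q ^ (q * t + e)             ≡⟨ cong (n ^ c *_) (^-distribˡ-+-* q (q * t) e) ⟩
  n ^ c * (q ^ (q * t) * q ^ e)       ≤⟨ *-mono-≤ n^c≤2^t (*-monoʳ-≤ (q ^ (q * t)) (^-monoˡ-≤ e (n≤1+n q))) ⟩
  2 ^ t * (q ^ (q * t) * suc q ^ e)   ≡⟨ *-assoc (2 ^ t) _ _ ⟨
  2 ^ t * q ^ (q * t) * suc q ^ e     ≡⟨ cong (λ z → 2 ^ t * z * suc q ^ e) (^-*-assoc q q t) ⟨
  2 ^ t * (q ^ q) ^ t * suc q ^ e     ≡⟨ cong (_* suc q ^ e) (*-^-distrib 2 (q ^ q) t) ⟨
  (2 * q ^ q) ^ t * suc q ^ e         ≤⟨ *-monoˡ-≤ (suc q ^ e) (^-monoˡ-≤ t (2≤[1+1/q]^q q)) ⟩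
  (suc q ^ q) ^ t * suc q ^ e         ≡⟨ cong (_* suc q ^ e) (^-*-assoc (suc q) q t) ⟩
  suc q ^ (q * t) * suc q ^ e         ≡⟨ ^-distribˡ-+-* (suc q) (q * t) e ⟨
  suc q ^ (q * t + e)                 ∎
  where
  open ≤-Reasoning
  t = suc ⌊log₂ n ⌋ * c
  n^c≤2^t : n ^ c ≤ 2 ^ t
  n^c≤2^t = ≤-trans (^-monoˡ-≤ c (<⇒≤ (n<2^[1+⌊log₂n⌋] n)))
                    (≤-reflexive (^-*-assoc 2 (suc ⌊log₂ n ⌋) c))

module Parameters (D : ℕ) .{{_ : NonZero D}} (c : ℕ) where

  -- For this q and h = m / (2D), (1 + 1/q²)^m ≤ (1 + 1/q)^h; as the gap is 2h, another factor
  -- (1 + 1/q)^h is left to beat n^c.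
  q : ℕ
  q = 2 * (4 * D)

  instance
    4D≢0 : NonZero (4 * D)
    4D≢0 = m*n≢0 4 D

    q≢0 : NonZero q
    q≢0 = m*n≢0 2 (4 * D)

    2D≢0 : NonZero (2 * D)
    2D≢0 = m*n≢0 2 D

  -- With L = `⌊log₂ n ⌋` ≥ 1, the term `2 * (q * c)` covers q (L + 1) c ≤ 2 q c L; the extra 1
  -- keeps h ≥ 1 even when `c` is 0.
  K : ℕ
  K = suc (2 * (q * c))

  threshold : ℕ
  threshold = K * (2 * D)

  gap : ℕ → ℕ
  gap m = m / (2 * D) + m / (2 * D)

  gap-bound : ∀ m → D * gap m ≤ m
  gap-bound m = ≤-trans (≤-reflexive (double D (m / (2 * D)))) (m/n*n≤m m (2 * D))
    where
    double : ∀ D h → D * (h + h) ≡ h * (2 * D)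
    double = solve-∀

  tail-small : ∀ {n m} → 2 ≤ n → threshold * ⌊log₂ n ⌋ ≤ m →
               n ^ c * (q ^ gap m * suc (q * q) ^ m) ≤ suc q ^ gap m * (q * q) ^ m
  tail-small {n} {m} 2≤n Clog≤m = begin
    n ^ c * (q ^ (h + h) * suc (q * q) ^ m)
      ≡⟨ cong (λ z → n ^ c * (z * suc (q * q) ^ m)) (^-distribˡ-+-* q h h) ⟩
    n ^ c * (q ^ h * q ^ h * suc (q * q) ^ m)
      ≡⟨ regroup (n ^ c) (q ^ h) (suc (q * q) ^ m) ⟩
    n ^ c * q ^ h * (suc (q * q) ^ m * q ^ h)
      ≤⟨ *-mono-≤ (polynomial-vs-exponential q n c h large) (square-vs-linear-^ (4 * D) h m m≤4Dh) ⟩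
    suc q ^ h * (suc q ^ h * (q * q) ^ m)
      ≡⟨ *-assoc (suc q ^ h) _ _ ⟨
    suc q ^ h * suc q ^ h * (q * q) ^ m
      ≡⟨ cong (_* (q * q) ^ m) (^-distribˡ-+-* (suc q) h h) ⟨
    suc q ^ (h + h) * (q * q) ^ m ∎
    where
    open ≤-Reasoning
    h = m / (2 * D)
    L = ⌊log₂ n ⌋
    regroup : ∀ a b c → a * (b * b * c) ≡ a * b * (c * b)
    regroup = solve-∀
    1≤L : 1 ≤ L
    1≤L = ≤-trans (≤-reflexive (sym (⌊log₂[2^n]⌋≡n 1))) (⌊log₂⌋-mono-≤ 2≤n)
    KL≤h : K * L ≤ h
    KL≤h = ≤-trans (≤-reflexive (sym (m*n/n≡m (K * L) (2 * D))))
      (/-monoˡ-≤ (2 * D) (≤-trans (≤-reflexive (swap K L (2 * D))) Clog≤m))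
      where
      swap : ∀ a b c → a * b * c ≡ a * c * b
      swap = solve-∀
    large : q * (suc L * c) ≤ h
    large = begin
      q * (suc L * c)         ≤⟨ *-monoʳ-≤ q (*-monoˡ-≤ c (+-monoˡ-≤ L 1≤L)) ⟩
      q * ((L + L) * c)       ≡⟨ expand q L c ⟩
      2 * (q * c) * L         ≤⟨ m≤n+m _ L ⟩
      K * L                   ≤⟨ KL≤h ⟩
      h                       ∎
      where
      expand : ∀ q L c → q * ((L + L) * c) ≡ 2 * (q * c) * L
      expand = solve-∀
    1≤h : 1 ≤ h
    1≤h = ≤-trans (≤-trans 1≤L (m≤m+n L _)) KL≤h
    -- As h ≥ 1, doubling h absorbs the rounding in m / (2D). This is the origin of the 4 in `q`.
    m≤4Dh : m ≤ 4 * D * h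
    m≤4Dh = begin
      m                         ≡⟨ m≡m%n+[m/n]*n m (2 * D) ⟩
      m % (2 * D) + h * (2 * D) ≤⟨ +-monoˡ-≤ (h * (2 * D)) (<⇒≤ (m%n<n m (2 * D))) ⟩
      2 * D + h * (2 * D)       ≡⟨⟩
      suc h * (2 * D)           ≤⟨ *-monoˡ-≤ (2 * D) (+-monoˡ-≤ h 1≤h) ⟩
      (h + h) * (2 * D)         ≡⟨ expand h D ⟩
      4 * D * h                 ∎
      where
      expand : ∀ h D → (h + h) * (2 * D) ≡ 4 * D * h
      expand = solve-∀

-- Matchings

length-filter-∑ : ∀ {A : Set} {P : A → Set} (P? : Decidable P) xs →
                  length (filter P? xs) ≡ ∑[ x ∈ xs ] 𝟙 (P? x)
length-filter-∑ P? []       = refl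
length-filter-∑ P? (x ∷ xs) with P? x
... | yes _ = cong suc (length-filter-∑ P? xs)
... | no _  = length-filter-∑ P? xs

length-filter-split : ∀ {A : Set} {P : A → Set} (P? : Decidable P) xs →
                      length xs ≡ length (filter P? xs) + length (filter (¬? ∘ P?) xs)
length-filter-split P? []       = refl
length-filter-split P? (x ∷ xs) with P? x
... | yes _ = cong suc (length-filter-split P? xs)
... | no _  = trans (cong suc (length-filter-split P? xs)) (sym (+-suc _ _))

unique-⊆⇒length≤ : ∀ {A : Set} {xs ys : List A} → Unique xs → xs ⊆ ys → length xs ≤ length ys
unique-⊆⇒length≤ {xs = []}     _           _     = z≤n
unique-⊆⇒length≤ {xs = x ∷ xs} (x∉xs ∷ xs!) xs⊆ys with ∈-∃++ (xs⊆ys (here refl))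
... | as , bs , refl = begin
  suc (length xs)           ≤⟨ s≤s (unique-⊆⇒length≤ xs! xs⊆as++bs) ⟩
  suc (length (as ++ bs))   ≡⟨ cong suc (length-++ as) ⟩
  suc (length as + length bs) ≡⟨ +-suc (length as) (length bs) ⟨
  length as + suc (length bs) ≡⟨ length-++ as ⟨
  length (as ++ x ∷ bs)     ∎
  where
  open ≤-Reasoning
  xs⊆as++bs : xs ⊆ as ++ bs
  xs⊆as++bs y∈xs with ∈-++⁻ as (xs⊆ys (there y∈xs))
  ... | inj₁ y∈as          = ∈-++⁺ˡ y∈as
  ... | inj₂ (here refl)   = contradiction refl (All.lookup x∉xs y∈xs)
  ... | inj₂ (there y∈bs)  = ∈-++⁺ʳ as y∈bs

_≟ᴱ_ : (e f : Edge n) → Dec (e ≡ f)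
edge u v u<v ≟ᴱ edge u' v' u'<v' with u Fin.≟ u' | v Fin.≟ v'
... | yes refl | yes refl = yes (cong (edge u v) (≤-irrelevant u<v u'<v'))
... | no u≢u'  | _        = no λ { refl → u≢u' refl }
... | yes _    | no v≢v'  = no λ { refl → v≢v' refl }

module _ {n : ℕ} where
  open DecMembership (_≟ᴱ_ {n}) public using (_∈?_)

disjoint? : (e f : Edge n) → Dec (Disjoint e f)
disjoint? e f =
  ¬? (u e Fin.≟ u f) ×-dec ¬? (u e Fin.≟ v f) ×-dec ¬? (v e Fin.≟ u f) ×-dec ¬? (v e Fin.≟ v f)

disjoint-sym : ∀ (e f : Edge n) → Disjoint e f → Disjoint f e
disjoint-sym _ _ (uu , uv , vu , vv) = ≢-sym uu , ≢-sym vu , ≢-sym uv , ≢-sym vv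

disjoint⇒≢ : ∀ (e f : Edge n) → Disjoint e f → e ≢ f
disjoint⇒≢ _ _ (uu , _) refl = uu refl

matching-unique : {M : List (Edge n)} → IsMatching M → Unique M
matching-unique = AllPairs.map (λ {e f} → disjoint⇒≢ e f)

Free : List (Edge n) → Edge n → Set
Free N e = All (Disjoint e) N

free? : (N : List (Edge n)) → Decidable (Free N)
free? N e = All.all? (disjoint? e) N

matching-remove : ∀ {e} {M : List (Edge n)} → e ∈ M → IsMatching M →
                  length M ≤ suc (length (filter (disjoint? e) M))
matching-remove {e = e} {M = e ∷ M} (here refl) (e# ∷ _) =
  s≤s (≤-reflexive (cong length (sym
    (trans (filter-reject (disjoint? e) (λ e#e → disjoint⇒≢ e e e#e refl)) (filter-all (disjoint? e) e#)))))
matching-remove {e = e} {M = f ∷ M} (there e∈M) (f# ∷ M#) = ≤-trans (s≤s (matching-remove e∈M M#))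
  (≤-reflexive (cong (suc ∘ length) (sym (filter-accept (disjoint? e) (disjoint-sym f e (All.lookup f# e∈M))))))

IsMaxMatchingAvoiding : (E S M : List (Edge n)) → Set
IsMaxMatchingAvoiding E S M = M ⊆ E × IsMatching M × All (Free S) M ×
  (∀ M' → M' ⊆ E → IsMatching M' → All (Free S) M' → length M' ≤ length M)

-- The recursion needs matchings that also avoid the edges S chosen so far.
maxMatchingAvoiding : (E S : List (Edge n)) → ∃ (IsMaxMatchingAvoiding E S)
maxMatchingAvoiding [] S = [] , id , [] , [] , λ where
  []      _    _ _ → z≤n
  (_ ∷ _) M'⊆[] _ _ → contradiction (M'⊆[] (here refl)) λ ()
maxMatchingAvoiding (e ∷ E) S with free? S e | maxMatchingAvoiding E S | maxMatchingAvoiding E (e ∷ S)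
... | no e#̸S | M , M⊆E , M# , M#S , M-max | _ =
  M , (λ x∈ → there (M⊆E x∈)) , M# , M#S , λ M' M'⊆ M'# M'#S →
    M-max M' (λ x∈M' → drop M'#S x∈M' (M'⊆ x∈M')) M'# M'#S
  where
  drop : ∀ {M'} → All (Free S) M' → ∀ {x} → x ∈ M' → x ∈ e ∷ E → x ∈ E
  drop M'#S x∈M' (here refl) = contradiction (All.lookup M'#S x∈M') e#̸S
  drop M'#S x∈M' (there x∈E) = x∈E
... | yes e#S | M₀ , M₀⊆E , M₀# , M₀#S , M₀-max | M₁ , M₁⊆E , M₁# , M₁#eS , M₁-max
  = result (≤-total (length M₀) (suc (length M₁)))
  where
  -- Without `e`, the rest of `M'` avoids `e` as well as `S` and so competes with `M₁`.
  with-e : ∀ M' → M' ⊆ e ∷ E → IsMatching M' → All (Free S) M' → e ∈ M' →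
           length M' ≤ suc (length M₁)
  with-e M' M'⊆ M'# M'#S e∈M' = ≤-trans (matching-remove e∈M' M'#)
    (s≤s (M₁-max _ rest⊆E (AllPairs.filter⁺ (disjoint? e) M'#)
       (All.zipWith (λ {x} (e#x , x#S) → disjoint-sym e x e#x ∷ x#S)
         (All.all-filter (disjoint? e) M' , All.filter⁺ (disjoint? e) M'#S))))
    where
    rest⊆E : filter (disjoint? e) M' ⊆ E
    rest⊆E x∈ with ∈-filter⁻ (disjoint? e) {xs = M'} x∈
    ... | x∈M' , e#x with M'⊆ x∈M'
    ...   | here refl = contradiction refl (disjoint⇒≢ e e e#x)
    ...   | there x∈E = x∈E
  without-e : ∀ M' → M' ⊆ e ∷ E → IsMatching M' → All (Free S) M' → e ∉ M' →
              length M' ≤ length M₀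
  without-e M' M'⊆ M'# M'#S e∉M' = M₀-max M' (λ x∈M' → drop x∈M' (M'⊆ x∈M')) M'# M'#S
    where
    drop : ∀ {x} → x ∈ M' → x ∈ e ∷ E → x ∈ E
    drop x∈M' (here refl) = contradiction x∈M' e∉M'
    drop x∈M' (there x∈E) = x∈E
  bound : ∀ {B} → length M₀ ≤ B → suc (length M₁) ≤ B →
          ∀ M' → M' ⊆ e ∷ E → IsMatching M' → All (Free S) M' → length M' ≤ B
  bound h₀ h₁ M' M'⊆ M'# M'#S with e ∈? M'
  ... | yes e∈M' = ≤-trans (with-e M' M'⊆ M'# M'#S e∈M') h₁
  ... | no e∉M'  = ≤-trans (without-e M' M'⊆ M'# M'#S e∉M') h₀
  result : length M₀ ≤ suc (length M₁) ⊎ suc (length M₁) ≤ length M₀ →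
           ∃ (IsMaxMatchingAvoiding (e ∷ E) S)
  result (inj₁ h) = e ∷ M₁ , (λ { (here refl) → here refl ; (there x∈) → there (M₁⊆E x∈) })
    , All.map (λ {x} x#eS → disjoint-sym x e (All.head x#eS)) M₁#eS ∷ M₁# , e#S ∷ All.map All.tail M₁#eS , bound h ≤-refl
  result (inj₂ h) = M₀ , (λ x∈ → there (M₀⊆E x∈)) , M₀# , M₀#S , bound ≤-refl h

maxMatching : (E : List (Edge n)) → ∃ (IsMaxMatching E)
maxMatching E with maxMatchingAvoiding E []
... | M , M⊆E , M# , _ , M-max = M , M⊆E , M# , λ M' M'⊆E M'# → M-max M' M'⊆E M'# (All.tabulate (λ _ → []))

-- Computed from an actual maximum matching, so that Φ is a function on labellings, with a sum over
-- all of them and a decidable bad set.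
matchingNumber : List (Edge n) → ℕ
matchingNumber E = length (proj₁ (maxMatching E))

matching≤ : ∀ {E M : List (Edge n)} → M ⊆ E → IsMatching M → length M ≤ matchingNumber E
matching≤ {E = E} {M} M⊆E M# = proj₂ (proj₂ (proj₂ (maxMatching E))) M M⊆E M#

matching-disjoint : ∀ {M : List (Edge n)} → IsMatching M → ∀ {e f} → e ∈ M → f ∈ M → e ≢ f → Disjoint e f
matching-disjoint (e# ∷ M#) (here refl) (here refl) e≢f = contradiction refl e≢f
matching-disjoint (e# ∷ M#) (here refl) (there f∈)  e≢f = All.lookup e# f∈
matching-disjoint (f# ∷ M#) {e} {f} (there e∈) (here refl) e≢f = disjoint-sym f e (All.lookup f# e∈)
matching-disjoint (_ ∷ M#)  (there e∈)  (there f∈)  e≢f = matching-disjoint M# e∈ f∈ e≢f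

unique-⊆-matching : ∀ {M N : List (Edge n)} → IsMatching M → Unique N → N ⊆ M → IsMatching N
unique-⊆-matching M# []         N⊆M = []
unique-⊆-matching M# (e∉N ∷ N!) N⊆M =
  All.tabulate (λ f∈N → matching-disjoint M# (N⊆M (here refl)) (N⊆M (there f∈N)) (All.lookup e∉N f∈N))
  ∷ unique-⊆-matching M# N! (λ f∈N → N⊆M (there f∈N))

incident? : (x : Fin n) (e : Edge n) → Dec (x ≡ u e ⊎ x ≡ v e)
incident? x e = (x Fin.≟ u e) ⊎-dec (x Fin.≟ v e)

incident-count≤1 : ∀ {M : List (Edge n)} → IsMatching M → ∀ x → ∑[ e ∈ M ] 𝟙 (incident? x e) ≤ 1
incident-count≤1 {M = []}    []        x = z≤n
incident-count≤1 {M = e ∷ M} (e# ∷ M#) x with incident? x e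
... | no _    = incident-count≤1 M# x
... | yes x∈e = s≤s (≤-trans (∑-mono-∈ M none) (≤-reflexive (∑-zero M)))
  where
  none : ∀ {f} → f ∈ M → 𝟙 (incident? x f) ≤ 0
  none {f} f∈M with incident? x f
  ... | no _    = z≤n
  ... | yes x∈f = contradiction (All.lookup e# f∈M) (clash x∈e x∈f)
    where
    clash : x ≡ u e ⊎ x ≡ v e → x ≡ u f ⊎ x ≡ v f → ¬ Disjoint e f
    clash (inj₁ refl) (inj₁ eq) (uu , _)         = uu eq
    clash (inj₁ refl) (inj₂ eq) (_ , uv , _)     = uv eq
    clash (inj₂ refl) (inj₁ eq) (_ , _ , vu , _) = vu eq
    clash (inj₂ refl) (inj₂ eq) (_ , _ , _ , vv) = vv eq

𝟙-yes : {P : Set} (P? : Dec P) → P → 1 ≤ 𝟙 P?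
𝟙-yes (yes _) _ = ≤-refl
𝟙-yes (no ¬p) p = contradiction p ¬p

𝟙-mono : {P Q : Set} (P? : Dec P) (Q? : Dec Q) → (P → Q) → 𝟙 P? ≤ 𝟙 Q?
𝟙-mono (no _)  Q? P⇒Q = z≤n
𝟙-mono (yes p) Q? P⇒Q = 𝟙-yes Q? (P⇒Q p)

-- An edge of `M` that meets `f` contains an endpoint of `f`, and each of the two endpoints lies on
-- at most one edge of `M`.
touched-count≤2 : ∀ {M : List (Edge n)} → IsMatching M → ∀ f →
                  ∑[ e ∈ M ] 𝟙 (¬? (disjoint? e f)) ≤ 2
touched-count≤2 {M = M} M# f = begin
  ∑[ e ∈ M ] 𝟙 (¬? (disjoint? e f))
    ≤⟨ ∑-mono M by-endpoint ⟩
  ∑[ e ∈ M ] (𝟙 (incident? (u f) e) + 𝟙 (incident? (v f) e))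
    ≡⟨ ∑-+ M _ _ ⟩
  ∑[ e ∈ M ] 𝟙 (incident? (u f) e) + ∑[ e ∈ M ] 𝟙 (incident? (v f) e)
    ≤⟨ +-mono-≤ (incident-count≤1 M# (u f)) (incident-count≤1 M# (v f)) ⟩
  2 ∎
  where
  open ≤-Reasoning
  by-endpoint : ∀ e → 𝟙 (¬? (disjoint? e f)) ≤ 𝟙 (incident? (u f) e) + 𝟙 (incident? (v f) e)
  by-endpoint e with incident? (u f) e | incident? (v f) e
  ... | yes _ | _     = m≤n⇒m≤n+o _ (𝟙≤1 (¬? (disjoint? e f)))
  ... | no _  | yes _ = 𝟙≤1 (¬? (disjoint? e f))
  -- The right side is 0 here; `no id` decides the empty type, whose indicator is that same 0.
  ... | no uf∉e | no vf∉e = 𝟙-mono (¬? (disjoint? e f)) (no id) λ touch → touch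
    ( (λ eq → uf∉e (inj₁ (sym eq))) , (λ eq → vf∉e (inj₁ (sym eq)))
    , (λ eq → uf∉e (inj₂ (sym eq))) , (λ eq → vf∉e (inj₂ (sym eq))))

length≤free+2*length : ∀ {M : List (Edge n)} → IsMatching M → ∀ N →
                       length M ≤ ∑[ e ∈ M ] 𝟙 (free? N e) + 2 * length N
length≤free+2*length {M = M} M# [] = ≤-reflexive (sym (trans (+-identityʳ _)
  (trans (∑-const M 1) (*-identityʳ _))))
length≤free+2*length {M = M} M# (f ∷ N) = begin
  length M
    ≤⟨ length≤free+2*length M# N ⟩
  ∑[ e ∈ M ] 𝟙 (free? N e) + 2 * length N
    ≤⟨ +-monoˡ-≤ (2 * length N) (∑-mono M extend) ⟩
  ∑[ e ∈ M ] (𝟙 (free? (f ∷ N) e) + 𝟙 (¬? (disjoint? e f))) + 2 * length N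
    ≡⟨ cong (_+ 2 * length N) (∑-+ M _ _) ⟩
  ∑[ e ∈ M ] 𝟙 (free? (f ∷ N) e) + ∑[ e ∈ M ] 𝟙 (¬? (disjoint? e f)) + 2 * length N
    ≤⟨ +-monoˡ-≤ (2 * length N) (+-monoʳ-≤ (∑[ e ∈ M ] 𝟙 (free? (f ∷ N) e)) (touched-count≤2 M# f)) ⟩
  ∑[ e ∈ M ] 𝟙 (free? (f ∷ N) e) + 2 + 2 * length N
    ≡⟨ regroup _ (length N) ⟩
  ∑[ e ∈ M ] 𝟙 (free? (f ∷ N) e) + 2 * suc (length N) ∎
  where
  open ≤-Reasoning
  regroup : ∀ a l → a + 2 + 2 * l ≡ a + 2 * suc l
  regroup = solve-∀
  extend : ∀ e → 𝟙 (free? N e) ≤ 𝟙 (free? (f ∷ N) e) + 𝟙 (¬? (disjoint? e f))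
  extend e = by-cases (disjoint? e f)
    where
    by-cases : (d : Dec (Disjoint e f)) → 𝟙 (free? N e) ≤ 𝟙 (free? (f ∷ N) e) + 𝟙 (¬? d)
    by-cases (no _)    = ≤-trans (𝟙≤1 (free? N e)) (m≤n+m 1 _)
    by-cases (yes e#f) = ≤-trans (𝟙-mono (free? N e) (free? (f ∷ N) e) (e#f ∷_)) (m≤m+n _ _)

-- Pieces of a labelled edge list

piece-⊆ : (E : List (Edge n)) (p : Partition k E) (i : Fin k) → piece E p i ⊆ E
piece-⊆ [] [] i x∈ = x∈
piece-⊆ (e ∷ E) (j ∷ p) i x∈ with j Fin.≟ i
piece-⊆ (e ∷ E) (j ∷ p) i (here refl) | yes _ = here refl
piece-⊆ (e ∷ E) (j ∷ p) i (there x∈)  | yes _ = there (piece-⊆ E p i x∈)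
piece-⊆ (e ∷ E) (j ∷ p) i x∈          | no _  = there (piece-⊆ E p i x∈)

piece-matching : (E : List (Edge n)) (p : Partition k E) (i : Fin k) →
                 IsMatching E → IsMatching (piece E p i)
piece-matching [] [] i [] = []
piece-matching (e ∷ E) (j ∷ p) i (e# ∷ E#) with j Fin.≟ i
... | yes _ = All.tabulate (λ x∈ → All.lookup e# (piece-⊆ E p i x∈)) ∷ piece-matching E p i E#
... | no _  = piece-matching E p i E#

-- Double sums over pieces collapse to this single pass over the list (`∑-pieces`), which can be
-- averaged one label at a time (`∑-labelSum`).
labelSum : (E : List (Edge n)) → Partition k E → (Fin k → Edge n → ℕ) → ℕ
labelSum []      []      g = 0
labelSum (e ∷ E) (j ∷ p) g = g j e + labelSum E p g

labelSum-mono : (E : List (Edge n)) (p : Partition k E) {g h : Fin k → Edge n → ℕ} →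
                (∀ i e → g i e ≤ h i e) → labelSum E p g ≤ labelSum E p h
labelSum-mono []      []      g≤h = z≤n
labelSum-mono (e ∷ E) (j ∷ p) g≤h = +-mono-≤ (g≤h j e) (labelSum-mono E p g≤h)

labelSum-unlabelled : (E : List (Edge n)) (p : Partition k E) (f : Edge n → ℕ) →
                      labelSum E p (const f) ≡ ∑ E f
labelSum-unlabelled []      []      f = refl
labelSum-unlabelled (e ∷ E) (j ∷ p) f = cong (f e +_) (labelSum-unlabelled E p f)

∑-allFin-suc : ∀ k (h : Fin (suc k) → ℕ) → ∑ (allFin (suc k)) h ≡ h Fin.zero + ∑ (allFin k) (h ∘ Fin.suc)
∑-allFin-suc k h = cong (h Fin.zero +_)
  (trans (cong (λ xs → ∑ xs h) (sym (map-tabulate id Fin.suc))) (∑-map Fin.suc (allFin k) h))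

∑-pick : ∀ {k} (j : Fin k) (h : Fin k → ℕ) → ∑[ i ∈ allFin k ] (𝟙 (j Fin.≟ i) * h i) ≡ h j
∑-pick {suc k} Fin.zero h = trans (∑-allFin-suc k (λ i → 𝟙 (Fin.zero Fin.≟ i) * h i))
  (trans (cong₂ _+_ (+-identityʳ (h Fin.zero)) (∑-zero (allFin k))) (+-identityʳ _))
∑-pick {suc k} (Fin.suc j) h = trans (∑-allFin-suc k (λ i → 𝟙 (Fin.suc j Fin.≟ i) * h i))
  (trans (∑-cong (allFin k) (λ i → cong (_* h (Fin.suc i)) (suc-≟ j i))) (∑-pick j (h ∘ Fin.suc)))
  where
  suc-≟ : ∀ {k} (j i : Fin k) → 𝟙 (Fin.suc j Fin.≟ Fin.suc i) ≡ 𝟙 (j Fin.≟ i)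
  suc-≟ j i with j Fin.≟ i
  ... | yes _ = refl
  ... | no _  = refl

∑-pieces : (E : List (Edge n)) (p : Partition k E) (g : Fin k → Edge n → ℕ) →
           ∑[ i ∈ allFin k ] ∑[ e ∈ piece E p i ] g i e ≡ labelSum E p g
∑-pieces {k = k} []      []      g = ∑-zero (allFin k)
∑-pieces {k = k} (e ∷ E) (j ∷ p) g = begin
  ∑[ i ∈ allFin k ] ∑ (piece (e ∷ E) (j ∷ p) i) (g i)
    ≡⟨ ∑-cong (allFin k) peel ⟩
  ∑[ i ∈ allFin k ] (𝟙 (j Fin.≟ i) * g i e + ∑ (piece E p i) (g i))
    ≡⟨ ∑-+ (allFin k) _ _ ⟩
  ∑[ i ∈ allFin k ] (𝟙 (j Fin.≟ i) * g i e) + ∑[ i ∈ allFin k ] ∑ (piece E p i) (g i)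
    ≡⟨ cong₂ _+_ (∑-pick j (λ i → g i e)) (∑-pieces E p g) ⟩
  g j e + labelSum E p g ∎
  where
  open ≡-Reasoning
  peel : ∀ i → ∑ (piece (e ∷ E) (j ∷ p) i) (g i) ≡ 𝟙 (j Fin.≟ i) * g i e + ∑ (piece E p i) (g i)
  peel i with j Fin.≟ i
  ... | yes _ = cong (_+ ∑ (piece E p i) (g i)) (sym (*-identityˡ (g i e)))
  ... | no _  = refl

-- Linearity of expectation, each label being uniform. The factor `k` on the left avoids the
-- exponent `length E` - 1 on the right.
∑-labelSum : (E : List (Edge n)) (g : Fin k → Edge n → ℕ) →
             k * ∑[ p ∈ vecs k (length E) ] labelSum E p g
               ≡ k ^ length E * ∑[ e ∈ E ] ∑[ i ∈ allFin k ] g i e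
∑-labelSum {k = k} [] g = trans (*-zeroʳ k) refl
∑-labelSum {k = k} (e ∷ E) g = begin
  k * ∑[ p ∈ vecs k (suc (length E)) ] labelSum (e ∷ E) p g
    ≡⟨ cong (k *_) (∑-vecs-suc k (length E) _) ⟩
  k * ∑[ i ∈ allFin k ] ∑[ p ∈ vecs k (length E) ] (g i e + labelSum E p g)
    ≡⟨ cong (k *_) (∑-cong (allFin k) (λ i → trans (∑-+ (vecs k (length E)) _ _)
         (cong (_+ S) (∑-vecs-const k (length E) (g i e))))) ⟩
  k * ∑[ i ∈ allFin k ] (k ^ length E * g i e + S)
    ≡⟨ cong (k *_) (trans (∑-+ (allFin k) _ _)
         (cong₂ _+_ (∑-*ˡ (k ^ length E) (allFin k) (λ i → g i e)) (∑-allFin-const k S))) ⟩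
  k * (k ^ length E * G + k * S)
    ≡⟨ cong (λ z → k * (k ^ length E * G + z)) (∑-labelSum E g) ⟩
  k * (k ^ length E * G + k ^ length E * ∑[ e ∈ E ] ∑[ i ∈ allFin k ] g i e)
    ≡⟨ collect k (k ^ length E) G _ ⟩
  k * k ^ length E * (G + ∑[ e ∈ E ] ∑[ i ∈ allFin k ] g i e) ∎
  where
  open ≡-Reasoning
  G = ∑[ i ∈ allFin k ] g i e
  S = ∑[ p ∈ vecs k (length E) ] labelSum E p g
  collect : ∀ k x a b → k * (x * a + x * b) ≡ k * x * (a + b)
  collect = solve-∀

piece-there : (e : Edge n) (E : List (Edge n)) (j : Fin k) (p : Partition k E) (i : Fin k) →
              piece E p i ⊆ piece (e ∷ E) (j ∷ p) i
piece-there e E j p i x∈ with j Fin.≟ i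
... | yes _ = there x∈
... | no _  = x∈

piece-here : (e : Edge n) (E : List (Edge n)) (j : Fin k) (p : Partition k E) →
             e ∈ piece (e ∷ E) (j ∷ p) j
piece-here e E j p with j Fin.≟ j
... | yes _  = here refl
... | no j≢j = contradiction refl j≢j

-- An edge that keeps its label stays in its piece, so every missing edge is charged to a position
-- where the labels differ.
relabelled≤hamming : (E : List (Edge n)) (p p' : Partition k E) →
  labelSum E p (λ i e → 𝟙 (¬? (e ∈? piece E p' i))) ≤ hamming p p'
relabelled≤hamming []      []      []        = z≤n
relabelled≤hamming (e ∷ E) (j ∷ p) (j' ∷ p') = +-mono-≤
  (𝟙-mono (¬? (e ∈? piece (e ∷ E) (j' ∷ p') j)) (¬? (j Fin.≟ j'))
     λ { e∉ refl → e∉ (piece-here e E j p') })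
  (≤-trans (labelSum-mono E p (λ i f →
     𝟙-mono (¬? (f ∈? piece (e ∷ E) (j' ∷ p') i)) (¬? (f ∈? piece E p' i)) (_∘ piece-there e E j' p' i)))
   (relabelled≤hamming E p p'))

-- Resampling a matching

module Resampling (M R : List (Edge n)) (M# : IsMatching M) (r : Partition k R) where

  combined : Partition k M → Fin k → List (Edge n)
  combined s i = piece M s i ++ piece R r i

  totalMatching : Partition k M → ℕ
  totalMatching s = ∑[ i ∈ allFin k ] matchingNumber (combined s i)

  -- Summed along the old labelling, so that `i` is the label `e` had. Edges of `R` are never
  -- relabelled, so only edges of `M` can be lost.
  Lost : (Fin k → List (Edge n)) → Partition k M → Fin k → Edge n → Set
  Lost Ms s' i e = e ∈ Ms i × e ∉ piece M s' i

  lost? : ∀ Ms s' i → Decidable (Lost Ms s' i)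
  lost? Ms s' i e = (e ∈? Ms i) ×-dec ¬? (e ∈? piece M s' i)

  -- Each Ms i survives relabelling by dropping the edges that left piece i and adding the
  -- edges of M that arrived there without touching Ms i.
  exchange : ∀ s s' (Ms : Fin k → List (Edge n)) →
             (∀ i → Ms i ⊆ combined s i) → (∀ i → IsMatching (Ms i)) →
             ∑[ i ∈ allFin k ] length (Ms i) + labelSum M s' (λ i e → 𝟙 (free? (Ms i) e))
               ≤ totalMatching s' + labelSum M s (λ i e → 𝟙 (lost? Ms s' i e))
  exchange s s' Ms Ms⊆ Ms# = begin
    ∑[ i ∈ allFin k ] length (Ms i) + labelSum M s' (λ i e → 𝟙 (free? (Ms i) e))
      ≡⟨ cong (∑[ i ∈ allFin k ] length (Ms i) +_) (∑-pieces M s' _) ⟨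
    ∑[ i ∈ allFin k ] length (Ms i) + ∑[ i ∈ allFin k ] ∑[ e ∈ piece M s' i ] 𝟙 (free? (Ms i) e)
      ≡⟨ ∑-+ (allFin k) _ _ ⟨
    ∑[ i ∈ allFin k ] (length (Ms i) + ∑[ e ∈ piece M s' i ] 𝟙 (free? (Ms i) e))
      ≤⟨ ∑-mono (allFin k) per-piece ⟩
    ∑[ i ∈ allFin k ] (matchingNumber (combined s' i) + ∑[ e ∈ piece M s i ] 𝟙 (lost? Ms s' i e))
      ≡⟨ ∑-+ (allFin k) _ _ ⟩
    totalMatching s' + ∑[ i ∈ allFin k ] ∑[ e ∈ piece M s i ] 𝟙 (lost? Ms s' i e)
      ≡⟨ cong (totalMatching s' +_) (∑-pieces M s _) ⟩
    totalMatching s' + labelSum M s (λ i e → 𝟙 (lost? Ms s' i e)) ∎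
    where
    open ≤-Reasoning
    per-piece : ∀ i → length (Ms i) + ∑[ e ∈ piece M s' i ] 𝟙 (free? (Ms i) e)
                    ≤ matchingNumber (combined s' i) + ∑[ e ∈ piece M s i ] 𝟙 (lost? Ms s' i e)
    per-piece i = begin
      length (Ms i) + ∑[ e ∈ piece M s' i ] 𝟙 (free? (Ms i) e)
        ≡⟨ cong₂ _+_ (length-filter-split kept? (Ms i)) (sym (length-filter-∑ (free? (Ms i)) (piece M s' i))) ⟩
      length kept + length dropped + length new
        ≡⟨ swap (length kept) (length dropped) (length new) ⟩
      length kept + length new + length dropped
        ≡⟨ cong (_+ length dropped) (length-++ kept) ⟨
      length (kept ++ new) + length dropped
        ≤⟨ +-mono-≤ (matching≤ {E = combined s' i} kept++new⊆ kept++new#)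
                    (unique-⊆⇒length≤ (matching-unique (AllPairs.filter⁺ (¬? ∘ kept?) (Ms# i))) dropped⊆) ⟩
      matchingNumber (combined s' i) + length (filter (lost? Ms s' i) (piece M s i))
        ≡⟨ cong (matchingNumber (combined s' i) +_) (length-filter-∑ (lost? Ms s' i) (piece M s i)) ⟩
      matchingNumber (combined s' i) + ∑[ e ∈ piece M s i ] 𝟙 (lost? Ms s' i e) ∎
      where
      kept? : Decidable (_∈ combined s' i)
      kept? e = e ∈? combined s' i
      kept dropped new : List (Edge n)
      kept    = filter kept? (Ms i)
      dropped = filter (¬? ∘ kept?) (Ms i)
      new     = filter (free? (Ms i)) (piece M s' i)
      swap : ∀ a b c → a + b + c ≡ a + c + b
      swap = solve-∀
      kept++new⊆ : kept ++ new ⊆ combined s' i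
      kept++new⊆ e∈ with ∈-++⁻ kept e∈
      ... | inj₁ e∈kept = proj₂ (∈-filter⁻ kept? {xs = Ms i} e∈kept)
      ... | inj₂ e∈new  = ∈-++⁺ˡ (filter-⊆ (free? (Ms i)) (piece M s' i) e∈new)
      -- New edges are free of all of `Ms i`, hence of the kept ones, and disjoint from each other
      -- as edges of the matching `M`.
      kept++new# : IsMatching (kept ++ new)
      kept++new# = AllPairs.++⁺ (AllPairs.filter⁺ kept? (Ms# i))
        (AllPairs.filter⁺ (free? (Ms i)) (piece-matching M s' i M#))
        (All.tabulate λ {e} e∈kept → All.tabulate λ {f} f∈new →
          disjoint-sym f e (All.lookup (proj₂ (∈-filter⁻ (free? (Ms i)) {xs = piece M s' i} f∈new))
                                       (filter-⊆ kept? (Ms i) e∈kept)))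
      dropped⊆ : dropped ⊆ filter (lost? Ms s' i) (piece M s i)
      dropped⊆ e∈ with ∈-filter⁻ (¬? ∘ kept?) {xs = Ms i} e∈
      ... | e∈Ms , e∉s' with ∈-++⁻ (piece M s i) (Ms⊆ i e∈Ms)
      ...   | inj₁ e∈M = ∈-filter⁺ (lost? Ms s' i) e∈M (e∈Ms , e∉s' ∘ ∈-++⁺ˡ)
      ...   | inj₂ e∈R = contradiction (∈-++⁺ʳ (piece M s' i) e∈R) e∉s'

  -- `exchange` for maximum matchings at `s`, with the gain discarded; the loss counts only
  -- relabelled edges.
  totalMatching-lipschitz : Lipschitz totalMatching
  totalMatching-lipschitz s s' = begin
    totalMatching s
      ≤⟨ m≤m+n _ _ ⟩
    totalMatching s + labelSum M s' (λ i e → 𝟙 (free? (Ms i) e))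
      ≤⟨ exchange s s' Ms (λ i → proj₁ (proj₂ (maxMatching (combined s i))))
                          (λ i → proj₁ (proj₂ (proj₂ (maxMatching (combined s i))))) ⟩
    totalMatching s' + labelSum M s (λ i e → 𝟙 (lost? Ms s' i e))
      ≤⟨ +-monoʳ-≤ (totalMatching s') (≤-trans
           (labelSum-mono M s (λ i e → 𝟙-mono (lost? Ms s' i e) (¬? (e ∈? piece M s' i)) proj₂))
           (relabelled≤hamming M s s')) ⟩
    totalMatching s' + hamming s s' ∎
    where
    open ≤-Reasoning
    Ms : Fin k → List (Edge n)
    Ms i = proj₁ (maxMatching (combined s i))

  -- If all Ms i and the part of M inside their union are small, then a fresh random labelling
  -- of M is expected to destroy few edges of the Ms i and to offer many edges extending them.
  small⇒far : .{{_ : NonZero k}} → ∀ d g → (3 * d + 1) * g ≤ length M →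
    ∀ s (Ms : Fin k → List (Edge n)) →
    (∀ i → Ms i ⊆ combined s i) → (∀ i → IsMatching (Ms i)) →
    (∀ i → matchingNumber (combined s i) ≤ length (Ms i)) →
    (∀ i → (3 * d + 1) * length (Ms i) ≤ d * length M) →
    (3 * d + 1) * length (filter (_∈? unionAll k Ms) M) ≤ d * length M →
    FarBelowMean totalMatching g s
  small⇒far d g Dg≤m s Ms Ms⊆ Ms# Ms-max small union-small =
    *-cancelˡ-≤ D {{D≢0}} (begin
      D * (P * (totalMatching s + g))
        ≡⟨ distribute D P (totalMatching s) g ⟩
      D * (P * totalMatching s) + P * (D * g)
        ≤⟨ +-monoʳ-≤ _ (*-monoʳ-≤ P Dg≤m) ⟩
      D * (P * totalMatching s) + P * m
        ≤⟨ +-cancelʳ-≤ (P * (d * m)) _ _ with-loss ⟩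
      D * ∑ V totalMatching ∎)
    where
    open ≤-Reasoning
    D = 3 * d + 1
    m = length M
    P = k ^ m
    V = vecs k m
    U = filter (_∈? unionAll k Ms) M
    D≢0 : NonZero D
    D≢0 = >-nonZero (m≤n+m 1 (3 * d))
    distribute : ∀ D P t g → D * (P * (t + g)) ≡ D * (P * t) + P * (D * g)
    distribute = solve-∀
    gained : Fin k → Edge _ → ℕ
    gained i e = 𝟙 (free? (Ms i) e)

    lost≤U : ∀ s' → labelSum M s (λ i e → 𝟙 (lost? Ms s' i e)) ≤ length U
    lost≤U s' = ≤-trans
      (labelSum-mono M s λ i e → 𝟙-mono (lost? Ms s' i e) (e ∈? unionAll k Ms)
        λ (e∈Ms , _) → ∈-concatMap⁺ Ms (Any.map (λ { refl → e∈Ms }) (∈-allFin i)))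
      (≤-reflexive (trans (labelSum-unlabelled M s _) (sym (length-filter-∑ (_∈? unionAll k Ms) M))))

    mean-exchange : P * totalMatching s + ∑[ s' ∈ V ] labelSum M s' gained
                  ≤ ∑ V totalMatching + P * length U
    mean-exchange = begin
      P * totalMatching s + ∑[ s' ∈ V ] labelSum M s' gained
        ≡⟨ cong (_+ ∑[ s' ∈ V ] labelSum M s' gained) (∑-vecs-const k m (totalMatching s)) ⟨
      ∑ V (const (totalMatching s)) + ∑[ s' ∈ V ] labelSum M s' gained
        ≡⟨ ∑-+ V _ _ ⟨
      ∑[ s' ∈ V ] (totalMatching s + labelSum M s' gained)
        ≤⟨ ∑-mono V (λ s' → ≤-trans (+-monoˡ-≤ _ (∑-mono (allFin k) Ms-max))
             (≤-trans (exchange s s' Ms Ms⊆ Ms#) (+-monoʳ-≤ (totalMatching s') (lost≤U s')))) ⟩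
      ∑[ s' ∈ V ] (totalMatching s' + length U)
        ≡⟨ ∑-+ V _ _ ⟩
      ∑ V totalMatching + ∑ V (const (length U))
        ≡⟨ cong (∑ V totalMatching +_) (∑-vecs-const k m (length U)) ⟩
      ∑ V totalMatching + P * length U ∎

    -- Here `D` - 2d = `suc d`: a fraction (d + 1)/D of `M` stays free of each `Ms i`. Set against a
    -- loss of at most d/D, this leaves the 1/D that pays for `g`.
    free-count : ∀ i → suc d * m ≤ D * ∑[ e ∈ M ] gained i e
    free-count i = +-cancelʳ-≤ (2 * (d * m)) _ _ (begin
      suc d * m + 2 * (d * m)
        ≡⟨ expand d m ⟩
      D * m
        ≤⟨ *-monoʳ-≤ D (length≤free+2*length M# (Ms i)) ⟩
      D * (∑[ e ∈ M ] gained i e + 2 * length (Ms i))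
        ≡⟨ split D _ (length (Ms i)) ⟩
      D * ∑[ e ∈ M ] gained i e + 2 * (D * length (Ms i))
        ≤⟨ +-monoʳ-≤ (D * ∑[ e ∈ M ] gained i e) (*-monoʳ-≤ 2 (small i)) ⟩
      D * ∑[ e ∈ M ] gained i e + 2 * (d * m) ∎)
      where
      expand : ∀ d m → suc d * m + 2 * (d * m) ≡ (3 * d + 1) * m
      expand = solve-∀
      split : ∀ D x l → D * (x + 2 * l) ≡ D * x + 2 * (D * l)
      split = solve-∀

    mean-gain : P * (suc d * m) ≤ D * ∑[ s' ∈ V ] labelSum M s' gained
    mean-gain = *-cancelˡ-≤ k (begin
      k * (P * (suc d * m))
        ≡⟨ *-exchange k P (suc d * m) ⟩
      P * (k * (suc d * m))
        ≡⟨ cong (P *_) (∑-allFin-const k (suc d * m)) ⟨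
      P * ∑ (allFin k) (const (suc d * m))
        ≤⟨ *-monoʳ-≤ P (∑-mono (allFin k) free-count) ⟩
      P * ∑[ i ∈ allFin k ] (D * ∑[ e ∈ M ] gained i e)
        ≡⟨ cong (P *_) (trans (∑-*ˡ D (allFin k) _) (cong (D *_) (∑-swap (allFin k) M gained))) ⟩
      P * (D * ∑[ e ∈ M ] ∑[ i ∈ allFin k ] gained i e)
        ≡⟨ *-exchange P D _ ⟩
      D * (P * ∑[ e ∈ M ] ∑[ i ∈ allFin k ] gained i e)
        ≡⟨ cong (D *_) (∑-labelSum M gained) ⟨
      D * (k * ∑[ s' ∈ V ] labelSum M s' gained)
        ≡⟨ *-exchange D k _ ⟩
      k * (D * ∑[ s' ∈ V ] labelSum M s' gained) ∎)

    with-loss : D * (P * totalMatching s) + P * m + P * (d * m) ≤ D * ∑ V totalMatching + P * (d * m)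
    with-loss = begin
      D * (P * totalMatching s) + P * m + P * (d * m)
        ≡⟨ collect (D * (P * totalMatching s)) P m d ⟩
      D * (P * totalMatching s) + P * (suc d * m)
        ≤⟨ +-monoʳ-≤ _ mean-gain ⟩
      D * (P * totalMatching s) + D * ∑[ s' ∈ V ] labelSum M s' gained
        ≡⟨ *-distribˡ-+ D _ _ ⟨
      D * (P * totalMatching s + ∑[ s' ∈ V ] labelSum M s' gained)
        ≤⟨ *-monoʳ-≤ D mean-exchange ⟩
      D * (∑ V totalMatching + P * length U)
        ≡⟨ pull D _ P (length U) ⟩
      D * ∑ V totalMatching + P * (D * length U)
        ≤⟨ +-monoʳ-≤ _ (*-monoʳ-≤ P union-small) ⟩
      D * ∑ V totalMatching + P * (d * m) ∎
      where
      collect : ∀ x P m d → x + P * m + P * (d * m) ≡ x + P * (suc d * m)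
      collect = solve-∀
      pull : ∀ D x P u → D * (x + P * u) ≡ D * x + P * (D * u)
      pull = solve-∀

-- Splitting a labelling along an interleaving

module _ {A : Set} where

  leftLabels : ∀ {M R E : List (Edge n)} → Interleaving M R E → Vec A (length E) → Vec A (length M)
  leftLabels []        []      = []
  leftLabels (consˡ I) (j ∷ p) = j ∷ leftLabels I p
  leftLabels (consʳ I) (j ∷ p) = leftLabels I p

  rightLabels : ∀ {M R E : List (Edge n)} → Interleaving M R E → Vec A (length E) → Vec A (length R)
  rightLabels []        []      = []
  rightLabels (consˡ I) (j ∷ p) = rightLabels I p
  rightLabels (consʳ I) (j ∷ p) = j ∷ rightLabels I p

-- Fubini: a labelling of `E` is a pair of labellings of `R` and `M`. The labels of `R` are
-- outermost because the tail bound is applied with them held fixed.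
∑-split : ∀ {M R E : List (Edge n)} (I : Interleaving M R E) (f : Partition k R → Partition k M → ℕ) →
          ∑[ p ∈ vecs k (length E) ] f (rightLabels I p) (leftLabels I p)
            ≡ ∑[ r ∈ vecs k (length R) ] ∑[ s ∈ vecs k (length M) ] f r s
∑-split [] f = sym (+-identityʳ _)
∑-split {k = k} {M = _ ∷ M} {R} {_ ∷ E} (consˡ I) f = begin
  ∑[ p ∈ vecs k (suc (length E)) ] f (rightLabels (consˡ I) p) (leftLabels (consˡ I) p)
    ≡⟨ ∑-vecs-suc k (length E) _ ⟩
  ∑[ j ∈ allFin k ] ∑[ p ∈ vecs k (length E) ] f (rightLabels I p) (j ∷ leftLabels I p)
    ≡⟨ ∑-cong (allFin k) (λ j → ∑-split I (λ r s → f r (j ∷ s))) ⟩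
  ∑[ j ∈ allFin k ] ∑[ r ∈ vecs k (length R) ] ∑[ s ∈ vecs k (length M) ] f r (j ∷ s)
    ≡⟨ ∑-swap (allFin k) (vecs k (length R)) _ ⟩
  ∑[ r ∈ vecs k (length R) ] ∑[ j ∈ allFin k ] ∑[ s ∈ vecs k (length M) ] f r (j ∷ s)
    ≡⟨ ∑-cong (vecs k (length R)) (λ r → ∑-vecs-suc k (length M) (f r)) ⟨
  ∑[ r ∈ vecs k (length R) ] ∑[ s ∈ vecs k (suc (length M)) ] f r s ∎
  where open ≡-Reasoning
∑-split {k = k} {M = M} {_ ∷ R} {_ ∷ E} (consʳ I) f =
  trans (∑-vecs-suc k (length E) _)
  (trans (∑-cong (allFin k) (λ j → ∑-split I (λ r s → f (j ∷ r) s)))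
  (sym (∑-vecs-suc k (length R) (λ r → ∑[ s ∈ vecs k (length M) ] f r s))))

module _ {M R E : List (Edge n)} where

  interleaving-length : Interleaving M R E → length E ≡ length R + length M
  interleaving-length I =
    trans (↭-length (toPermutation I)) (trans (length-++ M) (+-comm (length M) (length R)))

-- The two lists may differ in order, so they are compared by inclusion, here and in
-- `combined⊆piece`; being a maximum matching depends on membership only.
piece⊆combined : ∀ {M R E : List (Edge n)} (I : Interleaving M R E) (p : Partition k E) i →
                 piece E p i ⊆ piece M (leftLabels I p) i ++ piece R (rightLabels I p) i
piece⊆combined [] [] i ()
piece⊆combined (consˡ I) (j ∷ p) i e∈ with j Fin.≟ i
piece⊆combined (consˡ I) (j ∷ p) i (here refl) | yes _ = here refl
piece⊆combined (consˡ I) (j ∷ p) i (there e∈)  | yes _ = there (piece⊆combined I p i e∈)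
piece⊆combined (consˡ I) (j ∷ p) i e∈          | no _  = piece⊆combined I p i e∈
piece⊆combined {M = M} (consʳ I) (j ∷ p) i e∈ with j Fin.≟ i
piece⊆combined {M = M} (consʳ I) (j ∷ p) i (here refl) | yes _ = ∈-insert (piece M (leftLabels I p) i)
piece⊆combined {M = M} (consʳ I) (j ∷ p) i (there e∈)  | yes _ =
  ++⁺ʳ (piece M (leftLabels I p) i) there (piece⊆combined I p i e∈)
piece⊆combined (consʳ I) (j ∷ p) i e∈ | no _ = piece⊆combined I p i e∈

combined⊆piece : ∀ {M R E : List (Edge n)} (I : Interleaving M R E) (p : Partition k E) i →
                 piece M (leftLabels I p) i ++ piece R (rightLabels I p) i ⊆ piece E p i
combined⊆piece {M = M} I p i e∈ with ∈-++⁻ (piece M (leftLabels I p) i) e∈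
... | inj₁ e∈M = fromLeft I p i e∈M
  where
  fromLeft : ∀ {M R E : List (Edge n)} (I : Interleaving M R E) (p : Partition k E) i →
             piece M (leftLabels I p) i ⊆ piece E p i
  fromLeft [] [] i ()
  fromLeft (consˡ I) (j ∷ p) i e∈ with j Fin.≟ i
  fromLeft (consˡ I) (j ∷ p) i (here refl) | yes _ = here refl
  fromLeft (consˡ I) (j ∷ p) i (there e∈)  | yes _ = there (fromLeft I p i e∈)
  fromLeft (consˡ I) (j ∷ p) i e∈          | no _  = fromLeft I p i e∈
  fromLeft {E = e ∷ E} (consʳ I) (j ∷ p) i e∈ = piece-there e E j p i (fromLeft I p i e∈)
... | inj₂ e∈R = fromRight I p i e∈R
  where
  fromRight : ∀ {M R E : List (Edge n)} (I : Interleaving M R E) (p : Partition k E) i →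
              piece R (rightLabels I p) i ⊆ piece E p i
  fromRight [] [] i ()
  fromRight (consʳ I) (j ∷ p) i e∈ with j Fin.≟ i
  fromRight (consʳ I) (j ∷ p) i (here refl) | yes _ = here refl
  fromRight (consʳ I) (j ∷ p) i (there e∈)  | yes _ = there (fromRight I p i e∈)
  fromRight (consʳ I) (j ∷ p) i e∈          | no _  = fromRight I p i e∈
  fromRight {E = e ∷ E} (consˡ I) (j ∷ p) i e∈ = piece-there e E j p i (fromRight I p i e∈)

-- The bad labellings and the large matching outside them

theorem3p1 : (d c : ℕ) → 1 ≤ d →
    ∃ λ (C : ℕ) → ∃ λ (N : ℕ) →
    (n : ℕ) → N ≤ n → (k : ℕ) → 1 ≤ k →
    (E : List (Edge n)) → Unique E →
    (Mstar : List (Edge n)) → IsMaxMatching E Mstar →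
    C * k * ⌊log₂ n ⌋ ≤ length Mstar →
    Σ (List (Partition k E)) λ L → Unique L × (length L * n ^ c ≤ k ^ length E) ×
    ((p : Partition k E) → ¬ (p ∈ L) →
    (Ms : Fin k → List (Edge n)) → ((i : Fin k) → IsMaxMatching (piece E p i) (Ms i)) →
    Σ (List (Edge n)) λ M → IsMatching M × (M ⊆ unionAll k Ms) ×
    (d * length Mstar ≤ (3 * d + 1) * length M))
-- From n = 2 on, `⌊log₂ n ⌋` is at least 1, as `tail-small` requires.
theorem3p1 d c _ = threshold , 2 , main
  where
  instance
    D≢0 : NonZero (3 * d + 1)
    D≢0 = >-nonZero (m≤n+m 1 (3 * d))
  open Parameters (3 * d + 1) c
  main : (n : ℕ) → 2 ≤ n → (k : ℕ) → 1 ≤ k →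
    (E : List (Edge n)) → Unique E →
    (Mstar : List (Edge n)) → IsMaxMatching E Mstar →
    threshold * k * ⌊log₂ n ⌋ ≤ length Mstar →
    Σ (List (Partition k E)) λ L → Unique L × (length L * n ^ c ≤ k ^ length E) ×
    ((p : Partition k E) → ¬ (p ∈ L) →
    (Ms : Fin k → List (Edge n)) → ((i : Fin k) → IsMaxMatching (piece E p i) (Ms i)) →
    Σ (List (Edge n)) λ M → IsMatching M × (M ⊆ unionAll k Ms) ×
    (d * length Mstar ≤ (3 * d + 1) * length M))
  main n 2≤n k 1≤k E E! Mstar (Mstar⊆E , Mstar# , _) large =
    filter bad? (vecs k (length E)) , Unique.filter⁺ bad? (vecs-unique k (length E)) , few , good
    where
    instance
      k≢0 : NonZero k
      k≢0 = >-nonZero 1≤k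
    M R : List (Edge n)
    -- The edges of `Mstar` in the order of `E`, so that `M` and `R` interleave to `E` and labels
    -- can be split by position.
    M = filter (_∈? Mstar) E
    R = filter (¬? ∘ (_∈? Mstar)) E
    I : Interleaving M R E
    I = Interleaving.filter⁺ (setoid (Edge n)) (_∈? Mstar) E
    m g : ℕ
    m = length M
    g = gap m
    M# : IsMatching M
    M# = unique-⊆-matching Mstar# (Unique.filter⁺ (_∈? Mstar) E!)
      (λ e∈ → proj₂ (∈-filter⁻ (_∈? Mstar) {xs = E} e∈))
    Mstar≤M : length Mstar ≤ m
    Mstar≤M = unique-⊆⇒length≤ (matching-unique Mstar#)
      (λ e∈ → ∈-filter⁺ (_∈? Mstar) (Mstar⊆E e∈) e∈)
    open Resampling M R M#
    -- Badness refers to `p` alone, never to the matchings `Ms`; hence one exceptional list serves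
    -- every choice of maximum matchings.
    bad? : Decidable (λ p → FarBelowMean (totalMatching (rightLabels I p)) g (leftLabels I p))
    bad? p = farBelowMean? (totalMatching (rightLabels I p)) g (leftLabels I p)
    few : length (filter bad? (vecs k (length E))) * n ^ c ≤ k ^ length E
    few = *-cancelʳ-≤ _ _ X {{m*n≢0 (q ^ g) (suc (q * q) ^ m) {{m^n≢0 q g}} {{m^n≢0 (suc (q * q)) m}}}} (begin
      length bad * n ^ c * X
        ≡⟨ *-assoc (length bad) (n ^ c) X ⟩
      length bad * (n ^ c * X)
        ≤⟨ *-monoʳ-≤ (length bad) (tail-small 2≤n large′) ⟩
      length bad * Y
        ≡⟨ cong (_* Y) (length-filter-∑ bad? (vecs k (length E))) ⟩
      (∑[ p ∈ vecs k (length E) ] 𝟙 (bad? p)) * Y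
        ≡⟨ cong (_* Y) (∑-split I (λ r s → 𝟙 (farBelowMean? (totalMatching r) g s))) ⟩
      (∑[ r ∈ vecs k (length R) ] ∑[ s ∈ vecs k m ] 𝟙 (farBelowMean? (totalMatching r) g s)) * Y
        ≡⟨ ∑-*ʳ (vecs k (length R)) _ Y ⟨
      ∑[ r ∈ vecs k (length R) ] ((∑[ s ∈ vecs k m ] 𝟙 (farBelowMean? (totalMatching r) g s)) * Y)
        ≤⟨ ∑-mono (vecs k (length R)) (λ r → lower-tail q (totalMatching r) (totalMatching-lipschitz r) g) ⟩
      ∑ (vecs k (length R)) (const (q ^ g * (suc (q * q) ^ m * k ^ m)))
        ≡⟨ ∑-vecs-const k (length R) _ ⟩
      k ^ length R * (q ^ g * (suc (q * q) ^ m * k ^ m))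
        ≡⟨ collect (k ^ length R) (q ^ g) (suc (q * q) ^ m) (k ^ m) ⟩
      k ^ length R * k ^ m * X
        ≡⟨ cong (_* X) (trans (cong (k ^_) (interleaving-length I)) (^-distribˡ-+-* k (length R) m)) ⟨
      k ^ length E * X ∎)
      where
      open ≤-Reasoning
      bad = filter bad? (vecs k (length E))
      X = q ^ g * suc (q * q) ^ m
      Y = suc q ^ g * (q * q) ^ m
      collect : ∀ a b c d → a * (b * (c * d)) ≡ a * d * (b * c)
      collect = solve-∀
      large′ : threshold * ⌊log₂ n ⌋ ≤ m
      large′ = ≤-trans (*-monoˡ-≤ ⌊log₂ n ⌋ (m≤m*n threshold k)) (≤-trans large Mstar≤M)
    good : (p : Partition k E) → ¬ (p ∈ filter bad? (vecs k (length E))) →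
      (Ms : Fin k → List (Edge n)) → ((i : Fin k) → IsMaxMatching (piece E p i) (Ms i)) →
      Σ (List (Edge n)) λ M → IsMatching M × (M ⊆ unionAll k Ms) ×
      (d * length Mstar ≤ (3 * d + 1) * length M)
    good p p∉bad Ms Ms-max with any? (λ i → d * m ≤? (3 * d + 1) * length (Ms i)) (allFin k)
                              | d * m ≤? (3 * d + 1) * length (filter (_∈? unionAll k Ms) M)
    ... | yes large-piece | _ with Any.satisfied large-piece
    ...   | i , dm≤ = Ms i , proj₁ (proj₂ (Ms-max i)) , Ms⊆union i , ≤-trans (*-monoʳ-≤ d Mstar≤M) dm≤
      where
      Ms⊆union : ∀ i → Ms i ⊆ unionAll k Ms
      Ms⊆union i e∈Ms = ∈-concatMap⁺ Ms (Any.map (λ { refl → e∈Ms }) (∈-allFin i))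
    good p p∉bad Ms Ms-max | no _ | yes dm≤ =
      filter (_∈? unionAll k Ms) M , AllPairs.filter⁺ (_∈? unionAll k Ms) M#
      , (λ e∈ → proj₂ (∈-filter⁻ (_∈? unionAll k Ms) {xs = M} e∈)) , ≤-trans (*-monoʳ-≤ d Mstar≤M) dm≤
    good p p∉bad Ms Ms-max | no no-large-piece | no ¬dm≤ =
      contradiction (∈-filter⁺ bad? (∈-vecs p) far) p∉bad
      where
      r = rightLabels I p
      s = leftLabels I p
      far : FarBelowMean (totalMatching r) g s
      far = small⇒far r d g (gap-bound m) s Ms
        (λ i e∈ → piece⊆combined I p i (proj₁ (Ms-max i) e∈))
        (λ i → proj₁ (proj₂ (Ms-max i)))
        (λ i → let (N , N⊆ , N# , _) = maxMatching (combined r s i) in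
           proj₂ (proj₂ (Ms-max i)) N (λ e∈ → combined⊆piece I p i (N⊆ e∈)) N#)
        (λ i → <⇒≤ (≰⇒> λ dm≤ → no-large-piece (Any.map (λ { refl → dm≤ }) (∈-allFin i))))
        (<⇒≤ (≰⇒> ¬dm≤))
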